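{- For every $\varepsilon\in(0,1)$ there exists $N_{\varepsilon}$ such that the following holds. Let $G$ be a graph on $N \geq N_{\varepsilon}$ vertices whose maximum degree is bounded by $D_{\varepsilon,N} = \frac{\varepsilon^2}{32}\sqrt{N}$. Let $\tau^f$ be an optimal stopping time for the full information game on $G$ and let $\tau^b$ be an optimal stopping time for the blind game on $G$. Then \[ \mathbb{E}[\tilde{C}_{\tau^b}] \leq \mathbb{E}[\tilde{C}_{\tau^f}] \leq \mathbb{E}[\tilde{C}_{\tau^b}] + \varepsilon N . \]
   Context: All graphs are finite, simple and undirected. Let $G=(V,E)$ be a graph with $|V|=N$. Let $\mathcal{S}$ be the set of all permutations $\sigma=(\sigma_1,\ldots,\sigma_N)$ of $V$, with the uniform probability measure ($\mathbb{P}[\{\sigma\}]=1/N!$). For $t\in\{1,\ldots,N\}$, $\tilde{G}_t(\sigma)$ is the subgraph of $G$ induced by $\{\sigma_1,\ldots,\sigma_t\}$, and $\tilde{C}_t(\sigma)$ is the number of connected components of $\tilde{G}_t(\sigma)$. Given a filtration $\mathcal{P}_1\subseteq\cdots\subseteq\mathcal{P}_N$ of $\sigma$-algebras of subsets of $\mathcal{S}$, a stopping time is a function $\tau:\mathcal{S}\to\{1,\ldots,N\}$ with $\tau^{ -1}(t)\in\mathcal{P}_t$ for all $t\le N$. The payoff of $\tau$ is $\mathbb{E}[\tilde{C}_\tau]=\frac{1}{N!}\sum_{\sigma\in\mathcal{S}}\tilde{C}_{\tau(\sigma)}(\sigma)$. A stopping time is optimal if it maximizes $\mathbb{E}[\tilde{C}_\tau]$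 among all stopping times for the given filtration. Blind game: $\mathcal{P}_t=\{\emptyset,\mathcal{S}\}$ for every $t$ (so stopping times are constants). Full information game: $\mathcal{P}_t$ consists of all $A\subseteq\mathcal{S}$ such that whenever $\sigma\in A$ and $\pi\in\mathcal{S}$ satisfies $\pi_i=\sigma_i$ for all $i\le t$, then $\pi\in A$ (the selector, who knows $G$, knows all vertices revealed up to time $t$). -}

module Defs where

open import Level using (0ℓ)
open import Data.Fin.Base as Fin using (Fin; toℕ; inject≤)
open import Data.Fin.Properties as Fin using (toℕ<n)
open import Data.Integer.Base as ℤ using (+_; +[1+_])
import Data.Integer.Properties as ℤ
import Data.Integer.Tactic.RingSolver as ℤ-Solver
open import Data.List.Base as List
  using (List; []; _∷_; length; filter; deduplicate; allFin; mapMaybe; cartesianProductWith)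
open import Data.List.Extrema.Nat using (max)
open import Data.List.Membership.Propositional using (_∈_)
open import Data.List.Membership.Propositional.Properties using (∈-allFin)
open import Data.List.Relation.Unary.Any using (here; there)
open import Data.Maybe.Base using (Maybe; just; nothing)
open import Data.Nat.Base as ℕ using (ℕ; zero; suc; _!; z≤n; s≤s)
open import Data.Nat.ListAction using (sum)
open import Data.Nat.Properties as ℕ using (_!≢0)
import Data.Nat.Tactic.RingSolver as ℕ-Solver
open import Data.Product.Base using (∃; _×_; _,_; proj₁; proj₂)
open import Data.Rational.Base as ℚ using (ℚ; mkℚ; 0ℚ; 1ℚ; ½; _/_; ∣_∣; 1/_)
import Data.Rational.Properties as ℚ
open import Data.Rational.Solver using (module +-*-Solver)
import Data.Rational.Unnormalised.Base as ℚᵘ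
import Data.Rational.Unnormalised.Properties as ℚᵘ
open import Data.Sum.Base as Sum using (_⊎_; inj₁; inj₂)
open import Data.Vec.Base as Vec using (Vec; lookup)
open import Data.Vec.Relation.Unary.AllPairs using (allPairs?)
open import Data.Vec.Relation.Unary.Unique.Propositional using (Unique)
open import Function.Base using (_∘_; id)
open import Relation.Binary.Construct.Closure.ReflexiveTransitive
  using (Star; ε; _◅_; _◅◅_)
open import Relation.Binary.Core using (Rel)
open import Relation.Binary.Definitions using (Decidable; Symmetric; Irreflexive)
open import Relation.Binary.PropositionalEquality
  using (_≡_; refl; sym; trans; cong; cong₂; subst; subst₂)
open import Relation.Nullary.Decidable using (yes; no; map′; _×-dec_; _⊎-dec_; ¬?)
open import Relation.Unary using (Pred; ∅; U; ∁; _∪_; _≐_)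

-- Reals are Cauchy sequences of rationals; equality of reals is not
-- _≡_ but the equivalence induced by _≤ℝ_.
Cauchy : (ℕ → ℚ) → Set
Cauchy s = ∀ δ → 0ℚ ℚ.< δ →
  ∃ λ K → ∀ m n → K ℕ.≤ m → K ℕ.≤ n → ∣ s m ℚ.- s n ∣ ℚ.≤ δ

record ℝ : Set where
  field
    seq    : ℕ → ℚ
    cauchy : Cauchy seq

open ℝ public

infix 4 _≤ℝ_ _<ℝ_
infixl 6 _+ℝ_
infixl 7 _*ℝ_

_≤ℝ_ : Rel ℝ 0ℓ
x ≤ℝ y = ∀ δ → 0ℚ ℚ.< δ → ∃ λ K → ∀ n → K ℕ.≤ n → seq x n ℚ.≤ seq y n ℚ.+ δ

_<ℝ_ : Rel ℝ 0ℓ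
x <ℝ y = ∃ λ δ → 0ℚ ℚ.< δ × ∃ λ K → ∀ n → K ℕ.≤ n → seq x n ℚ.+ δ ℚ.≤ seq y n

fromℚ : ℚ → ℝ
fromℚ q = record
  { seq    = λ _ → q
  ; cauchy = λ δ 0<δ → 0 , λ _ _ _ _ →
      subst (ℚ._≤ δ) (sym (cong ∣_∣ (ℚ.+-inverseʳ q))) (ℚ.<⇒≤ 0<δ)
  }

fromℕ : ℕ → ℝ
fromℕ n = fromℚ (+ n / 1)

private
  *-pos : ∀ {p q} → 0ℚ ℚ.< p → 0ℚ ℚ.< q → 0ℚ ℚ.< p ℚ.* q
  *-pos {p} {q} 0<p 0<q = ℚ.positive⁻¹ (p ℚ.* q) {{ℚ.pos*pos⇒pos p {{ℚ.positive 0<p}} q {{ℚ.positive 0<q}}}}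

  *-mono-≤ : ∀ {p p′ q q′} → 0ℚ ℚ.≤ q → 0ℚ ℚ.≤ p′ → p ℚ.≤ p′ → q ℚ.≤ q′ → p ℚ.* q ℚ.≤ p′ ℚ.* q′
  *-mono-≤ {p} {p′} {q} {q′} 0≤q 0≤p′ p≤p′ q≤q′ = ℚ.≤-trans
    (ℚ.*-monoʳ-≤-nonNeg q {{ℚ.nonNegative 0≤q}} p≤p′)
    (ℚ.*-monoˡ-≤-nonNeg p′ {{ℚ.nonNegative 0≤p′}} q≤q′)

  bounded : (x : ℝ) → ∃ λ B → 0ℚ ℚ.< B × ∃ λ K → ∀ n → K ℕ.≤ n → ∣ seq x n ∣ ℚ.≤ B
  bounded x with cauchy x 1ℚ (ℚ.positive⁻¹ 1ℚ)
  ... | K , close = 1ℚ ℚ.+ ∣ c ∣ , 0<B , K , λ n K≤n → begin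
        ∣ seq x n ∣                 ≡⟨ cong ∣_∣ (rearrange (seq x n) c) ⟩
        ∣ (seq x n ℚ.- c) ℚ.+ c ∣   ≤⟨ ℚ.∣p+q∣≤∣p∣+∣q∣ (seq x n ℚ.- c) c ⟩
        ∣ seq x n ℚ.- c ∣ ℚ.+ ∣ c ∣ ≤⟨ ℚ.+-monoˡ-≤ ∣ c ∣ (close n K K≤n ℕ.≤-refl) ⟩
        1ℚ ℚ.+ ∣ c ∣                ∎
    where
    open ℚ.≤-Reasoning
    c = seq x K
    0<B : 0ℚ ℚ.< 1ℚ ℚ.+ ∣ c ∣
    0<B = ℚ.+-mono-<-≤ (ℚ.positive⁻¹ 1ℚ) (ℚ.0≤∣p∣ c)
    rearrange : ∀ a b → a ≡ (a ℚ.- b) ℚ.+ b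
    rearrange = solve 2 (λ a b → a := (a :- b) :+ b) refl
      where open +-*-Solver

_+ℝ_ : ℝ → ℝ → ℝ
x +ℝ y = record { seq = λ n → seq x n ℚ.+ seq y n ; cauchy = sumCauchy }
  where
  open ℚ.≤-Reasoning
  interchange : ∀ a b c d → (a ℚ.+ b) ℚ.- (c ℚ.+ d) ≡ (a ℚ.- c) ℚ.+ (b ℚ.- d)
  interchange = solve 4 (λ a b c d → (a :+ b) :- (c :+ d) := (a :- c) :+ (b :- d)) refl
    where open +-*-Solver
  halves : ∀ δ → ½ ℚ.* δ ℚ.+ ½ ℚ.* δ ≡ δ
  halves δ = trans (sym (ℚ.*-distribʳ-+ δ ½ ½)) (ℚ.*-identityˡ δ)
  sumCauchy : Cauchy (λ n → seq x n ℚ.+ seq y n)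
  sumCauchy δ 0<δ
    with cauchy x (½ ℚ.* δ) (*-pos (ℚ.positive⁻¹ ½) 0<δ)
       | cauchy y (½ ℚ.* δ) (*-pos (ℚ.positive⁻¹ ½) 0<δ)
  ... | K , cx | L , cy = K ℕ.⊔ L , λ m n K≤m K≤n → begin
      ∣ (seq x m ℚ.+ seq y m) ℚ.- (seq x n ℚ.+ seq y n) ∣
        ≡⟨ cong ∣_∣ (interchange (seq x m) (seq y m) (seq x n) (seq y n)) ⟩
      ∣ (seq x m ℚ.- seq x n) ℚ.+ (seq y m ℚ.- seq y n) ∣
        ≤⟨ ℚ.∣p+q∣≤∣p∣+∣q∣ (seq x m ℚ.- seq x n) (seq y m ℚ.- seq y n) ⟩
      ∣ seq x m ℚ.- seq x n ∣ ℚ.+ ∣ seq y m ℚ.- seq y n ∣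
        ≤⟨ ℚ.+-mono-≤ (cx m n (ℕ.m⊔n≤o⇒m≤o K L K≤m) (ℕ.m⊔n≤o⇒m≤o K L K≤n))
                      (cy m n (ℕ.m⊔n≤o⇒n≤o K L K≤m) (ℕ.m⊔n≤o⇒n≤o K L K≤n)) ⟩
      ½ ℚ.* δ ℚ.+ ½ ℚ.* δ
        ≡⟨ halves δ ⟩
      δ ∎

private
  split : ∀ B C δ → 0ℚ ℚ.< B → 0ℚ ℚ.< C → 0ℚ ℚ.< δ →
          ∃ λ η → 0ℚ ℚ.< η × B ℚ.* η ℚ.+ η ℚ.* C ≡ δ
  split B C δ 0<B 0<C 0<δ = scaled (B ℚ.+ C) refl (ℚ.positive (ℚ.+-mono-< 0<B 0<C))
    where
    open ℚ.≤-Reasoning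
    scaled : ∀ D → B ℚ.+ C ≡ D → ℚ.Positive D →
             ∃ λ η → 0ℚ ℚ.< η × B ℚ.* η ℚ.+ η ℚ.* C ≡ δ
    scaled D B+C≡D D-pos = η , *-pos (ℚ.positive⁻¹ D⁻¹ {{ℚ.1/pos⇒pos D {{D-pos}}}}) 0<δ , (begin-equality
      B ℚ.* η ℚ.+ η ℚ.* C  ≡⟨ cong (B ℚ.* η ℚ.+_) (ℚ.*-comm η C) ⟩
      B ℚ.* η ℚ.+ C ℚ.* η  ≡⟨ ℚ.*-distribʳ-+ η B C ⟨
      (B ℚ.+ C) ℚ.* η      ≡⟨ cong (ℚ._* η) B+C≡D ⟩
      D ℚ.* η              ≡⟨ ℚ.*-assoc D D⁻¹ δ ⟨
      D ℚ.* D⁻¹ ℚ.* δ      ≡⟨ cong (ℚ._* δ) (ℚ.*-inverseʳ D {{ℚ.pos⇒nonZero D {{D-pos}}}}) ⟩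
      1ℚ ℚ.* δ             ≡⟨ ℚ.*-identityˡ δ ⟩
      δ                    ∎)
      where
      D⁻¹ = (1/ D) {{ℚ.pos⇒nonZero D {{D-pos}}}}
      η = D⁻¹ ℚ.* δ

  ∣ab-cd∣≤ : ∀ a b c d {B C η} → 0ℚ ℚ.≤ B → 0ℚ ℚ.≤ η →
             ∣ a ∣ ℚ.≤ B → ∣ b ℚ.- d ∣ ℚ.≤ η → ∣ a ℚ.- c ∣ ℚ.≤ η → ∣ d ∣ ℚ.≤ C →
             ∣ a ℚ.* b ℚ.- c ℚ.* d ∣ ℚ.≤ B ℚ.* η ℚ.+ η ℚ.* C
  ∣ab-cd∣≤ a b c d {B} {C} {η} 0≤B 0≤η a≤ b-d≤ a-c≤ d≤ =
    subst (λ r → ∣ r ∣ ℚ.≤ B ℚ.* η ℚ.+ η ℚ.* C) (sym (telescope a b c d))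
      (ℚ.≤-trans (ℚ.∣p+q∣≤∣p∣+∣q∣ (a ℚ.* (b ℚ.- d)) ((a ℚ.- c) ℚ.* d))
        (ℚ.+-mono-≤ (∣pq∣≤ a (b ℚ.- d) 0≤B a≤ b-d≤) (∣pq∣≤ (a ℚ.- c) d 0≤η a-c≤ d≤)))
    where
    telescope : ∀ a b c d → a ℚ.* b ℚ.- c ℚ.* d ≡ a ℚ.* (b ℚ.- d) ℚ.+ (a ℚ.- c) ℚ.* d
    telescope = solve 4 (λ a b c d → a :* b :- c :* d := a :* (b :- d) :+ (a :- c) :* d) refl
      where open +-*-Solver
    ∣pq∣≤ : ∀ p q {P Q} → 0ℚ ℚ.≤ P → ∣ p ∣ ℚ.≤ P → ∣ q ∣ ℚ.≤ Q → ∣ p ℚ.* q ∣ ℚ.≤ P ℚ.* Q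
    ∣pq∣≤ p q {P} {Q} 0≤P p≤ q≤ = subst (ℚ._≤ P ℚ.* Q) (sym (ℚ.∣p*q∣≡∣p∣*∣q∣ p q))
      (*-mono-≤ {∣ p ∣} {P} {∣ q ∣} {Q} (ℚ.0≤∣p∣ q) 0≤P p≤ q≤)

  productCauchy : ∀ {s t} → Cauchy s → Cauchy t →
                  ∀ {B C} → 0ℚ ℚ.< B → 0ℚ ℚ.< C →
                  ∀ {K₁ K₂} → (∀ n → K₁ ℕ.≤ n → ∣ s n ∣ ℚ.≤ B) → (∀ n → K₂ ℕ.≤ n → ∣ t n ∣ ℚ.≤ C) →
                  Cauchy (λ n → s n ℚ.* t n)
  productCauchy {s} {t} cs ct {B} {C} 0<B 0<C {K₁} {K₂} bs bt δ 0<δ =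
    let η , 0<η , total = split B C δ 0<B 0<C 0<δ
        K₃ , cs′ = cs η 0<η
        K₄ , ct′ = ct η 0<η
    in (K₁ ℕ.⊔ K₂) ℕ.⊔ (K₃ ℕ.⊔ K₄) , λ m n K≤m K≤n →
    let K₁₂≤m = ℕ.m⊔n≤o⇒m≤o (K₁ ℕ.⊔ K₂) (K₃ ℕ.⊔ K₄) K≤m
        K₁₂≤n = ℕ.m⊔n≤o⇒m≤o (K₁ ℕ.⊔ K₂) (K₃ ℕ.⊔ K₄) K≤n
        K₃₄≤m = ℕ.m⊔n≤o⇒n≤o (K₁ ℕ.⊔ K₂) (K₃ ℕ.⊔ K₄) K≤m
        K₃₄≤n = ℕ.m⊔n≤o⇒n≤o (K₁ ℕ.⊔ K₂) (K₃ ℕ.⊔ K₄) K≤n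
    in subst (∣ s m ℚ.* t m ℚ.- s n ℚ.* t n ∣ ℚ.≤_) total
      (∣ab-cd∣≤ (s m) (t m) (s n) (t n) (ℚ.<⇒≤ 0<B) (ℚ.<⇒≤ 0<η)
        (bs m (ℕ.m⊔n≤o⇒m≤o K₁ K₂ K₁₂≤m))
        (ct′ m n (ℕ.m⊔n≤o⇒n≤o K₃ K₄ K₃₄≤m) (ℕ.m⊔n≤o⇒n≤o K₃ K₄ K₃₄≤n))
        (cs′ m n (ℕ.m⊔n≤o⇒m≤o K₃ K₄ K₃₄≤m) (ℕ.m⊔n≤o⇒m≤o K₃ K₄ K₃₄≤n))
        (bt n (ℕ.m⊔n≤o⇒n≤o K₁ K₂ K₁₂≤n)))

_*ℝ_ : ℝ → ℝ → ℝ
x *ℝ y = record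
  { seq    = λ n → seq x n ℚ.* seq y n
  ; cauchy = let B , 0<B , _ , bx = bounded x
                 C , 0<C , _ , by = bounded y
             in productCauchy (cauchy x) (cauchy y) {B} {C} 0<B 0<C bx by
  }

⌊√_⌋ : ℕ → ℕ
⌊√ zero ⌋ = 0
⌊√ suc n ⌋ with suc ⌊√ n ⌋ ℕ.* suc ⌊√ n ⌋ ℕ.≤? suc n
... | yes _ = suc ⌊√ n ⌋
... | no  _ = ⌊√ n ⌋

⌊√⌋-lower : ∀ n → ⌊√ n ⌋ ℕ.* ⌊√ n ⌋ ℕ.≤ n
⌊√⌋-lower zero = z≤n
⌊√⌋-lower (suc n) with suc ⌊√ n ⌋ ℕ.* suc ⌊√ n ⌋ ℕ.≤? suc n
... | yes p = p
... | no  _ = ℕ.m≤n⇒m≤1+n (⌊√⌋-lower n)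

⌊√⌋-upper : ∀ n → n ℕ.< suc ⌊√ n ⌋ ℕ.* suc ⌊√ n ⌋
⌊√⌋-upper zero = s≤s z≤n
⌊√⌋-upper (suc n) with suc ⌊√ n ⌋ ℕ.* suc ⌊√ n ⌋ ℕ.≤? suc n
... | yes _ = ℕ.≤-trans (s≤s (⌊√⌋-upper n)) (ℕ.*-mono-< (ℕ.n<1+n (suc ⌊√ n ⌋)) (ℕ.n<1+n (suc ⌊√ n ⌋)))
... | no ¬p = ℕ.≰⇒> ¬p

private
  √-approx : ℕ → ℕ → ℚ
  √-approx n k = + ⌊√ n ℕ.* (suc k ℕ.* suc k) ⌋ / suc k

  square-cancel-≤ : ∀ a b → a ℕ.* a ℕ.≤ b ℕ.* b → a ℕ.≤ b
  square-cancel-≤ a b a²≤b² = ℕ.≮⇒≥ λ b<a → ℕ.<⇒≱ (ℕ.*-mono-< b<a b<a) a²≤b²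

  √-cross : ∀ n j k → let a = ⌊√ n ℕ.* (suc j ℕ.* suc j) ⌋ ; b = ⌊√ n ℕ.* (suc k ℕ.* suc k) ⌋ in
            a ℕ.* suc k ℕ.≤ suc b ℕ.* suc j
  √-cross n j k = square-cancel-≤ (a ℕ.* suc k) (suc b ℕ.* suc j) (begin
    (a ℕ.* suc k) ℕ.* (a ℕ.* suc k)           ≡⟨ regroup a (suc k) ⟩
    (a ℕ.* a) ℕ.* (suc k ℕ.* suc k)           ≤⟨ ℕ.*-monoˡ-≤ (suc k ℕ.* suc k) (⌊√⌋-lower (n ℕ.* (suc j ℕ.* suc j))) ⟩
    n ℕ.* (suc j ℕ.* suc j) ℕ.* (suc k ℕ.* suc k) ≡⟨ swap n (suc j ℕ.* suc j) (suc k ℕ.* suc k) ⟩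
    n ℕ.* (suc k ℕ.* suc k) ℕ.* (suc j ℕ.* suc j) ≤⟨ ℕ.*-monoˡ-≤ (suc j ℕ.* suc j) (ℕ.<⇒≤ (⌊√⌋-upper (n ℕ.* (suc k ℕ.* suc k)))) ⟩
    (suc b ℕ.* suc b) ℕ.* (suc j ℕ.* suc j)   ≡⟨ regroup (suc b) (suc j) ⟨
    (suc b ℕ.* suc j) ℕ.* (suc b ℕ.* suc j)   ∎)
    where
    open ℕ.≤-Reasoning
    a = ⌊√ n ℕ.* (suc j ℕ.* suc j) ⌋
    b = ⌊√ n ℕ.* (suc k ℕ.* suc k) ⌋
    regroup : ∀ x y → (x ℕ.* y) ℕ.* (x ℕ.* y) ≡ (x ℕ.* x) ℕ.* (y ℕ.* y)
    regroup = ℕ-Solver.solve-∀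
    swap : ∀ x y z → x ℕ.* y ℕ.* z ≡ x ℕ.* z ℕ.* y
    swap = ℕ-Solver.solve-∀

  suc-/ : ∀ b k → + suc b / suc k ≡ + b / suc k ℚ.+ + 1 / suc k
  suc-/ b k = ℚ.toℚᵘ-injective (begin
    ℚ.toℚᵘ (+ suc b / suc k)                        ≈⟨ ℚ.toℚᵘ-fromℚᵘ (ℚᵘ.mkℚᵘ (+ suc b) k) ⟩
    ℚᵘ.mkℚᵘ (+ suc b) k                             ≈⟨ ℚᵘ.*≡* (arith (+ b) (+ suc k)) ⟩
    ℚᵘ.mkℚᵘ (+ b) k ℚᵘ.+ ℚᵘ.mkℚᵘ (+ 1) k            ≈⟨ ℚᵘ.+-cong (ℚ.toℚᵘ-fromℚᵘ (ℚᵘ.mkℚᵘ (+ b) k)) (ℚ.toℚᵘ-fromℚᵘ (ℚᵘ.mkℚᵘ (+ 1) k)) ⟨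
    ℚ.toℚᵘ (+ b / suc k) ℚᵘ.+ ℚ.toℚᵘ (+ 1 / suc k)  ≈⟨ ℚ.toℚᵘ-homo-+ (+ b / suc k) (+ 1 / suc k) ⟨
    ℚ.toℚᵘ (+ b / suc k ℚ.+ + 1 / suc k)            ∎)
    where
    open import Relation.Binary.Reasoning.Setoid ℚᵘ.≃-setoid
    arith : ∀ x y → (ℤ.1ℤ ℤ.+ x) ℤ.* (y ℤ.* y) ≡ (x ℤ.* y ℤ.+ ℤ.1ℤ ℤ.* y) ℤ.* y
    arith = ℤ-Solver.solve-∀

  /-mono-≤ : ∀ a b j k → a ℕ.* suc k ℕ.≤ b ℕ.* suc j → + a / suc j ℚ.≤ + b / suc k
  /-mono-≤ a b j k le = ℚ.toℚᵘ-cancel-≤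
    (ℚᵘ.≤-respˡ-≃ (ℚᵘ.≃-sym (ℚ.toℚᵘ-fromℚᵘ (ℚᵘ.mkℚᵘ (+ a) j)))
    (ℚᵘ.≤-respʳ-≃ (ℚᵘ.≃-sym (ℚ.toℚᵘ-fromℚᵘ (ℚᵘ.mkℚᵘ (+ b) k)))
    (ℚᵘ.*≤* (subst₂ ℤ._≤_ (ℤ.pos-* a (suc k)) (ℤ.pos-* b (suc j)) (ℤ.+≤+ le)))))

  archimedean : ∀ δ → 0ℚ ℚ.< δ → ∃ λ K → ∀ n → K ℕ.≤ n → + 1 / suc n ℚ.≤ δ
  archimedean δ@(mkℚ +[1+ p ] d _) _ = d , λ n d≤n →
    ℚ.≤-trans (/-mono-≤ 1 (suc p) n d (ℕ.*-mono-≤ (s≤s (z≤n {p})) (s≤s d≤n)))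
              (ℚ.≤-reflexive (ℚ.fromℚᵘ-toℚᵘ δ))
  archimedean (mkℚ (+ 0) d _) (ℚ.*<* (ℤ.+<+ ()))
  archimedean (mkℚ (ℤ.-[1+ _ ]) d _) (ℚ.*<* ())

  √-step : ∀ n j k → √-approx n j ℚ.≤ √-approx n k ℚ.+ + 1 / suc k
  √-step n j k = subst (√-approx n j ℚ.≤_) (suc-/ b k) (/-mono-≤ a (suc b) j k (√-cross n j k))
    where
    a = ⌊√ n ℕ.* (suc j ℕ.* suc j) ⌋
    b = ⌊√ n ℕ.* (suc k ℕ.* suc k) ⌋

  ∣-∣≤ : ∀ p q {δ} → p ℚ.≤ q ℚ.+ δ → q ℚ.≤ p ℚ.+ δ → ∣ p ℚ.- q ∣ ℚ.≤ δ
  ∣-∣≤ p q {δ} p≤ q≤ with ℚ.∣p∣≡p∨∣p∣≡-p (p ℚ.- q)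
  ... | inj₁ eq rewrite eq = subst (p ℚ.- q ℚ.≤_) (cancel q δ) (ℚ.+-monoˡ-≤ (ℚ.- q) p≤)
    where
    open +-*-Solver
    cancel : ∀ a b → (a ℚ.+ b) ℚ.- a ≡ b
    cancel = solve 2 (λ a b → (a :+ b) :- a := b) refl
  ... | inj₂ eq rewrite eq = subst₂ ℚ._≤_ (flip p q) (cancel p δ) (ℚ.+-monoˡ-≤ (ℚ.- p) q≤)
    where
    open +-*-Solver
    cancel : ∀ a b → (a ℚ.+ b) ℚ.- a ≡ b
    cancel = solve 2 (λ a b → (a :+ b) :- a := b) refl
    flip : ∀ a b → b ℚ.- a ≡ ℚ.- (a ℚ.- b)
    flip = solve 2 (λ a b → b :- a := :- (a :- b)) refl

  cauchy-√ : ∀ n → Cauchy (√-approx n)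
  cauchy-√ n δ 0<δ =
    let K , small = archimedean δ 0<δ
    in K , λ j k K≤j K≤k → ∣-∣≤ (√-approx n j) (√-approx n k)
      (ℚ.≤-trans (√-step n j k) (ℚ.+-monoʳ-≤ (√-approx n k) (small k K≤k)))
      (ℚ.≤-trans (√-step n k j) (ℚ.+-monoʳ-≤ (√-approx n j) (small j K≤j)))

-- The k-th approximant is ⌊(k+1)√n⌋ / (k+1).
√ : ℕ → ℝ
√ n = record { seq = √-approx n ; cauchy = cauchy-√ n }

record Graph (n : ℕ) : Set₁ where
  field
    Adj    : Rel (Fin n) 0ℓ
    adj?   : Decidable Adj
    symm   : Symmetric Adj
    irrefl : Irreflexive _≡_ Adj

open Graph public

degree : ∀ {n} → Graph n → Fin n → ℕ
degree {n} G v = length (filter (adj? G v) (allFin n))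

maxDegree : ∀ {n} → Graph n → ℕ
maxDegree {n} G = max 0 (List.map (degree G) (allFin n))

-- For injective f this is (a copy on Fin m of) the subgraph of G induced
-- by the image of f.
induced : ∀ {m n} → Graph n → (Fin m → Fin n) → Graph m
induced G f = record
  { Adj    = λ u v → Adj G (f u) (f v)
  ; adj?   = λ u v → adj? G (f u) (f v)
  ; symm   = symm G
  ; irrefl = λ u≡v → irrefl G (cong f u≡v)
  }

Connected : ∀ {n} → Graph n → Rel (Fin n) 0ℓ
Connected G = Star (Adj G)

module _ {n} {R : Rel (Fin n) 0ℓ} (R? : Decidable R) where

  private
    -- Paths all of whose intermediate vertices lie in the given list.
    Via : List (Fin n) → Rel (Fin n) 0ℓ
    Via []       u v = u ≡ v ⊎ R u v
    Via (w ∷ ws) u v = Via ws u v ⊎ (Via ws u w × Via ws w v)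

    via? : ∀ ws → Decidable (Via ws)
    via? []       u v = (u Fin.≟ v) ⊎-dec R? u v
    via? (w ∷ ws) u v = via? ws u v ⊎-dec (via? ws u w ×-dec via? ws w v)

    via⇒star : ∀ ws {u v} → Via ws u v → Star R u v
    via⇒star []       (inj₁ refl)    = ε
    via⇒star []       (inj₂ r)       = r ◅ ε
    via⇒star (w ∷ ws) (inj₁ p)       = via⇒star ws p
    via⇒star (w ∷ ws) (inj₂ (p , q)) = via⇒star ws p ◅◅ via⇒star ws q

    base : ∀ ws {u v} → Via [] u v → Via ws u v
    base []       p = p
    base (w ∷ ws) p = inj₁ (base ws p)

    join : ∀ ws {u w v} → w ∈ ws → Via ws u w → Via ws w v → Via ws u v
    join (w ∷ ws) (here refl) p q = inj₂ (Sum.[ id , proj₁ ] p , Sum.[ id , proj₂ ] q)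
    join (w ∷ ws) (there i) (inj₁ p) (inj₁ q) = inj₁ (join ws i p q)
    join (w ∷ ws) (there i) (inj₁ p) (inj₂ (q , r)) = inj₂ (join ws i p q , r)
    join (w ∷ ws) (there i) (inj₂ (p , q)) (inj₁ r) = inj₂ (p , join ws i q r)
    join (w ∷ ws) (there i) (inj₂ (p , _)) (inj₂ (_ , r)) = inj₂ (p , r)

    star⇒via : ∀ {u v} → Star R u v → Via (allFin n) u v
    star⇒via ε       = base (allFin n) (inj₁ refl)
    star⇒via (r ◅ p) = join (allFin n) (∈-allFin _) (base (allFin n) (inj₂ r)) (star⇒via p)

  star? : Decidable (Star R)
  star? u v = map′ (via⇒star (allFin n)) star⇒via (via? (allFin n) u v)

connected? : ∀ {n} (G : Graph n) → Decidable (Connected G)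
connected? G = star? (adj? G)

-- The number of classes of the equivalence relation Connected G:
-- deduplicate keeps exactly one vertex of each class.
components : ∀ {n} → Graph n → ℕ
components {n} G = length (deduplicate (connected? G) (allFin n))

-- The index i : Fin N stands for
-- the position (or time) i + 1 in {1, …, N}.
record Permutation (N : ℕ) : Set where
  constructor permutation
  field
    vertices  : Vec (Fin N) N
    .distinct : Unique vertices

  at : Fin N → Fin N
  at = lookup vertices

open Permutation public using (vertices; at)

words : ∀ {a} {A : Set a} → List A → (k : ℕ) → List (Vec A k)
words as zero    = Vec.[] ∷ []
words as (suc k) = cartesianProductWith Vec._∷_ as (words as k)

toPermutation : ∀ {N} → Vec (Fin N) N → Maybe (Permutation N)
toPermutation v with allPairs? (λ x y → ¬? (x Fin.≟ y)) v
... | yes d = just (permutation v d)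
... | no  _ = nothing

permutations : (N : ℕ) → List (Permutation N)
permutations N = mapMaybe toPermutation (words (allFin N) N)

𝔼 : ∀ {N} → (Permutation N → ℕ) → ℚ
𝔼 {N} X = (+ sum (List.map X (permutations N)) / N !) {{N !≢0}}

G̃ : ∀ {N} → Graph N → (t : Fin N) → Permutation N → Graph (suc (toℕ t))
G̃ G t σ = induced G (λ i → at σ (inject≤ i (toℕ<n t)))

C̃ : ∀ {N} → Graph N → Fin N → Permutation N → ℕ
C̃ G t σ = components (G̃ G t σ)

Event : ℕ → Set₁
Event N = Pred (Permutation N) 0ℓ

-- The sample space is finite, so closure under binary unions is the
-- same as closure under countable ones.
record IsσAlgebra {N} (𝒜 : Pred (Event N) 0ℓ) : Set₁ where
  field
    resp-≐ : ∀ {A B} → A ≐ B → 𝒜 A → 𝒜 B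
    empty  : 𝒜 ∅
    compl  : ∀ {A} → 𝒜 A → 𝒜 (∁ A)
    union  : ∀ {A B} → 𝒜 A → 𝒜 B → 𝒜 (A ∪ B)

record Filtration (N : ℕ) : Set₁ where
  field
    𝒫          : Fin N → Pred (Event N) 0ℓ
    isσAlgebra : ∀ t → IsσAlgebra (𝒫 t)
    increasing : ∀ {s t} → s Fin.≤ t → ∀ {A} → 𝒫 s A → 𝒫 t A

open Filtration public using (𝒫)

IsStoppingTime : ∀ {N} → Filtration N → (Permutation N → Fin N) → Set
IsStoppingTime ℱ τ = ∀ t → 𝒫 ℱ t (λ σ → τ σ ≡ t)

payoff : ∀ {N} → Graph N → (Permutation N → Fin N) → ℚ
payoff G τ = 𝔼 (λ σ → C̃ G (τ σ) σ)

IsOptimal : ∀ {N} → Graph N → Filtration N → (Permutation N → Fin N) → Set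
IsOptimal G ℱ τ =
  IsStoppingTime ℱ τ × (∀ τ′ → IsStoppingTime ℱ τ′ → payoff G τ′ ℚ.≤ payoff G τ)

blind : (N : ℕ) → Filtration N
blind N = record
  { 𝒫          = λ _ A → A ≐ ∅ ⊎ A ≐ U
  ; isσAlgebra = λ _ → record
    { resp-≐ = λ (A⊆B , B⊆A) → Sum.map
        (λ (A⊆∅ , _) → A⊆∅ ∘ B⊆A , λ ())
        (λ (_ , U⊆A) → _ , A⊆B ∘ U⊆A)
    ; empty  = inj₁ (id , id)
    ; compl  = Sum.[ (λ (A⊆∅ , _) → inj₂ (_ , λ _ → A⊆∅))
                   , (λ (_ , U⊆A) → inj₁ ((λ ∉A → ∉A (U⊆A _)) , λ ())) ]
    ; union  = λ where
        (inj₁ (A⊆∅ , _)) (inj₁ (B⊆∅ , _)) → inj₁ (Sum.[ A⊆∅ , B⊆∅ ] , λ ())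
        (inj₁ _)         (inj₂ (_ , U⊆B)) → inj₂ (_ , inj₂ ∘ U⊆B)
        (inj₂ (_ , U⊆A)) _                → inj₂ (_ , inj₁ ∘ U⊆A)
    }
  ; increasing = λ _ → id
  }

AgreeUpTo : ∀ {N} → Fin N → Rel (Permutation N) 0ℓ
AgreeUpTo t σ π = ∀ i → i Fin.≤ t → at π i ≡ at σ i

full : (N : ℕ) → Filtration N
full N = record
  { 𝒫          = λ t A → ∀ σ π → A σ → AgreeUpTo t σ π → A π
  ; isσAlgebra = λ t → record
    { resp-≐ = λ (A⊆B , B⊆A) cl σ π σ∈B σ~π → A⊆B (cl σ π (B⊆A σ∈B) σ~π)
    ; empty  = λ _ _ ()
    ; compl  = λ cl σ π σ∉A σ~π π∈A → σ∉A (cl π σ π∈A λ i i≤t → sym (σ~π i i≤t))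
    ; union  = λ clA clB σ π σ∈A∪B σ~π →
        Sum.map (λ σ∈A → clA σ π σ∈A σ~π) (λ σ∈B → clB σ π σ∈B σ~π) σ∈A∪B
    }
  ; increasing = λ s≤t cl σ π σ∈A σ~π →
      cl σ π σ∈A λ i i≤s → σ~π i (ℕ.≤-trans i≤s s≤t)
  }

{-# OPTIONS --safe #-}

-- Exchanging two vertices of G changes the number of components of an
-- induced subgraph by at most D = 2 (maxDegree G + 1). Revealing σ one vertex
-- at a time therefore gives a martingale with increments at most D, so each
-- C̃_t has variance at most N D² / 2, which is of order ε⁴ N². A new vertex
-- creates at most one new component, so max_t C̃_t exceeds its maximum over a
-- grid of O(1/ε) times by at most a small multiple of ε N. By AM–GM and the
-- variance bound, the expected maximal deviation over the grid is also a small
-- multiple of ε N, so E[max_t C̃_t] ≤ max_t E[C̃_t] + ε N. Every constant time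
-- is a stopping time of the blind game.
--
-- Expectations are kept as sums over all permutations and denominators are
-- cleared, so this part of the argument takes place in ℕ with 1/q in place of ε.
module Submission where

open import Defs
open import Algebra.Properties.Semiring.Sum as Sum using ()
open import Data.Bool.Base using (Bool; true; false; _∧_; not)
open import Data.Bool.Properties as Bool using (∧-zeroʳ; ∧-identityʳ)
open import Data.Fin.Base as Fin using (Fin; zero; suc; toℕ; inject≤; inject₁; fromℕ<)
open import Data.Fin.Permutation as Perm using (_⟨$⟩ʳ_)
open import Data.Fin.Properties as Fin
  using (toℕ<n; inject≤-injective; toℕ-inject≤; toℕ-inject₁; toℕ-injective; toℕ-fromℕ<)
open import Data.Fin.Relation.Unary.Top using (view; ‵fromℕ; ‵inject₁)
import Data.Integer.Base as ℤ
import Data.Integer.Properties as ℤ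
import Data.Integer.Tactic.RingSolver as ℤ-Solver
open import Data.List.Base as List
  using (List; []; _∷_; _++_; length; filter; deduplicate; map; mapMaybe; allFin; tabulate; cartesianProductWith)
open import Data.List.Extrema.Nat using (xs≤max)
open import Data.List.Membership.Propositional using (_∈_; find; lose)
open import Data.List.Membership.Propositional.Properties
  using (∈-allFin; ∈-map⁺; ∈-++⁺ˡ; ∈-++⁺ʳ; ∈-filter⁺; ∈-lookup)
open import Data.List.Properties using (length-map; length-++; map-++; map-tabulate; map-∘)
import Data.List.Relation.Unary.All as ListAll
open import Data.List.Relation.Unary.AllPairs using (AllPairs; []; _∷_)
open import Data.List.Relation.Unary.Any using (here; there; index)
import Data.List.Relation.Unary.Any.Properties as Any
import Data.List.Relation.Unary.Unique.DecSetoid.Properties as Unique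
open import Data.Nat.Base as ℕ using (ℕ; zero; suc; z≤n; s≤s; _!; NonZero; _≥_)
import Data.Nat.DivMod as ℕ
import Data.Nat.ListAction as ListAction
open import Data.Nat.ListAction.Properties using (sum-++)
import Data.Nat.Properties as ℕ
import Data.Nat.Tactic.RingSolver as ℕ-Solver
open import Data.Product.Base using (∃; _×_; _,_; proj₁; proj₂)
open import Data.Rational.Base as ℚ using (0ℚ; 1ℚ; _/_)
import Data.Rational.Properties as ℚ
open import Data.Rational.Solver using (module +-*-Solver)
import Data.Rational.Unnormalised.Base as ℚᵘ
import Data.Rational.Unnormalised.Properties as ℚᵘ
open import Data.Sum.Base using (_⊎_; inj₁; inj₂)
open import Data.Unit.Base using (⊤; tt)
open import Data.Vec.Base as Vec using (Vec; []; _∷_; lookup)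
open import Data.Vec.Properties using (lookup-map)
open import Data.Vec.Relation.Unary.All as All using (All; []; _∷_)
open import Data.Vec.Relation.Unary.AllPairs using ([]; _∷_; allPairs?)
open import Data.Vec.Relation.Unary.Unique.Propositional using (Unique)
open import Data.Vec.Relation.Unary.Unique.Propositional.Properties using (lookup-injective)
open import Function.Base using (_∘_; id; it)
open import Function.Bundles using (module Injection; _⇔_; mk⇔)
open import Function.Properties.Inverse using (↔⇒↣)
open import Level using (0ℓ)
open import Relation.Binary.Bundles using (DecSetoid)
open import Relation.Binary.Construct.Closure.ReflexiveTransitive as Star
  using (_◅_; _◅◅_)
open import Relation.Binary.PropositionalEquality
open import Relation.Nullary.Decidable
  using (Dec; yes; no; does; dec-true; dec-false; does-⇔; ¬?; _×-dec_)
open import Relation.Nullary.Negation using (contradiction)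

module _ where

  open import Data.Nat.Base using (_+_; _*_; _∸_; _⊓_; _≤_; _<_; ∣_-_∣)
  open Sum ℕ.+-*-semiring
    using (sum; sum-syntax; sum-cong-≗; ∑-distrib-+; ∑-comm; sum-permute;
           *-distribˡ-sum; *-distribʳ-sum; sum-replicate-zero)

  -- Components under changes of the vertex set

  connectedDecSetoid : ∀ {n} → Graph n → DecSetoid 0ℓ 0ℓ
  connectedDecSetoid {n} G = record
    { Carrier = Fin n
    ; _≈_ = Connected G
    ; isDecEquivalence = record
      { isEquivalence = record
        { refl  = Star.ε
        ; sym   = Star.reverse (symm G)
        ; trans = _◅◅_
        }
      ; _≟_ = connected? G
      }
    }

  representatives : ∀ {n} → Graph n → List (Fin n)
  representatives {n} G = deduplicate (connected? G) (allFin n)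

  representative : ∀ {n} (G : Graph n) i → ∃ λ r → r ∈ representatives G × Connected G i r
  representative G i = find (Any.deduplicate⁺ (connected? G)
    (λ j∼k i∼k → i∼k ◅◅ Star.reverse (symm G) j∼k)
    (lose (∈-allFin i) Star.ε))

  AllPairs-lookup : ∀ {A : Set} {R : A → A → Set} {xs} → AllPairs R xs →
    ∀ {i j} → i Fin.< j → R (List.lookup xs i) (List.lookup xs j)
  AllPairs-lookup (Rx ∷ _)  {zero}  {suc j} _         = ListAll.lookup Rx (∈-lookup j)
  AllPairs-lookup (_  ∷ Rs) {suc i} {suc j} (s≤s i<j) = AllPairs-lookup Rs i<j

  -- With fewer labels than representatives, two distinct representatives would receive the same
  -- label by pigeonhole and so be connected, whereas `deduplicate` leaves only pairwise
  -- disconnected ones. `Label` is a relation because labels need not be constant on components.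
  components≤length : ∀ {n} {B : Set} (G : Graph n) (ys : List B) (Label : Fin n → B → Set) →
    (∀ i → ∃ λ y → y ∈ ys × Label i y) →
    (∀ {i j y} → Label i y → Label j y → Connected G i j) →
    components G ≤ length ys
  components≤length {n} G ys Label label compatible = ℕ.≮⇒≥ λ <length →
    let f = λ i → index (proj₁ (proj₂ (label (List.lookup (representatives G) i))))
        i , j , i<j , fi≡fj = Fin.pigeonhole <length f
        y , y∈ys , ly = label (List.lookup (representatives G) i)
        z , z∈ys , lz = label (List.lookup (representatives G) j)
        y≡z = trans (Any.lookup-index y∈ys) (trans (cong (List.lookup ys) fi≡fj) (sym (Any.lookup-index z∈ys)))
    in AllPairs-lookup (Unique.deduplicate-! (connectedDecSetoid G) (allFin n)) i<j
         (compatible (subst (Label _) y≡z ly) lz)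

  -- The labels are the images of the representatives of `H` together with the extra vertices: paths
  -- in `H` map to paths in `G`, so every vertex of `G` is connected to one of them.
  components-extend : ∀ {m n} (H : Graph m) (G : Graph n) (e : Fin m → Fin n) (xs : List (Fin n)) →
    (∀ {u v} → Adj H u v → Adj G (e u) (e v)) →
    (∀ i → (∃ λ j → i ≡ e j) ⊎ i ∈ xs) →
    components G ≤ components H + length xs
  components-extend {m} {n} H G e xs hom cover = begin
    components G          ≤⟨ components≤length G labels (Connected G) label
                               (λ i∼y j∼y → i∼y ◅◅ Star.reverse (symm G) j∼y) ⟩
    length labels         ≡⟨ length-++ (List.map e rs) ⟩
    length (List.map e rs) + length xs ≡⟨ cong (_+ length xs) (length-map e rs) ⟩
    length rs + length xs ∎
    where
    open ℕ.≤-Reasoning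
    rs = representatives H
    labels = List.map e rs ++ xs
    label : ∀ i → ∃ λ y → y ∈ labels × Connected G i y
    label i with cover i
    ... | inj₁ (j , refl) =
      let r , r∈rs , j∼r = representative H j
      in e r , ∈-++⁺ˡ (∈-map⁺ e r∈rs) , Star.gmap e hom j∼r
    ... | inj₂ i∈xs = i , ∈-++⁺ʳ (List.map e rs) i∈xs , Star.ε

  degree≤maxDegree : ∀ {n} (G : Graph n) v → degree G v ≤ maxDegree G
  degree≤maxDegree {n} G v =
    ListAll.lookup (xs≤max 0 (List.map (degree G) (allFin n))) (∈-map⁺ (degree G) (∈-allFin v))

  neighbours : ∀ {n} → Graph n → Fin n → List (Fin n)
  neighbours {n} G v = filter (adj? G v) (allFin n)

  module _ {n} (G : Graph n) (a b : Fin n) where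

    private
      touched : List (Fin n)
      touched = a ∷ b ∷ neighbours G a ++ neighbours G b

      touched-length : length touched ≤ 2 * suc (maxDegree G)
      touched-length = begin
        2 + length (neighbours G a ++ neighbours G b) ≡⟨ cong (2 +_) (length-++ (neighbours G a)) ⟩
        2 + (degree G a + degree G b)             ≤⟨ ℕ.+-monoʳ-≤ 2 (ℕ.+-mono-≤ (degree≤maxDegree G a) (degree≤maxDegree G b)) ⟩
        2 + (D + D)                               ≡⟨ cong suc (ℕ.+-suc D D) ⟨
        suc D + suc D                             ≡⟨ cong (suc D +_) (ℕ.+-identityʳ (suc D)) ⟨
        2 * suc D                                 ∎
        where
        open ℕ.≤-Reasoning
        D = maxDegree G

      adjacent⇒touched : ∀ {u v} → Adj G u v → v ≡ a ⊎ v ≡ b → u ∈ touched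
      adjacent⇒touched {u} u~v (inj₁ refl) =
        there (there (∈-++⁺ˡ (∈-filter⁺ (adj? G a) (∈-allFin u) (symm G u~v))))
      adjacent⇒touched {u} u~v (inj₂ refl) =
        there (there (∈-++⁺ʳ (neighbours G a) (∈-filter⁺ (adj? G b) (∈-allFin u) (symm G u~v))))

    -- A path in the old graph survives in the new one up to the first vertex
    -- that is, or is adjacent to, one of the exchanged vertices a and b.
    components-perturb : ∀ {m} (f g : Fin m → Fin n) → (∀ {i j} → f i ≡ f j → i ≡ j) →
      (∀ i → f i ≢ a → f i ≢ b → g i ≡ f i) →
      components (induced G g) ≤ components (induced G f) + 2 * suc (maxDegree G)
    components-perturb {m} f g f-injective g≡f = begin
      components H′                               ≤⟨ components≤length H′ labels Label label compatible ⟩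
      length labels                               ≡⟨ length-++ (List.map inj₁ rs) ⟩
      length (List.map inj₁ rs) + length (List.map inj₂ touched)
        ≡⟨ cong₂ _+_ (length-map inj₁ rs) (length-map inj₂ touched) ⟩
      length rs + length touched                  ≤⟨ ℕ.+-monoʳ-≤ (length rs) touched-length ⟩
      components H + 2 * suc (maxDegree G)        ∎
      where
      open ℕ.≤-Reasoning
      H = induced G f
      H′ = induced G g
      rs = representatives H
      labels : List (Fin m ⊎ Fin n)
      labels = List.map inj₁ rs ++ List.map inj₂ touched

      -- A position is labelled by an old representative if its path survives all the way, and
      -- otherwise by the touched vertex at which the path is cut. Injectivity of `f` makes the
      -- position of that vertex unique, so equal labels force connection.
      Label : Fin m → Fin m ⊎ Fin n → Set
      Label i (inj₁ r) = Connected H′ i r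
      Label i (inj₂ x) = ∃ λ j → f j ≡ x × Connected H′ i j

      compatible : ∀ {i j y} → Label i y → Label j y → Connected H′ i j
      compatible {y = inj₁ r} i∼r j∼r = i∼r ◅◅ Star.reverse (symm H′) j∼r
      compatible {y = inj₂ x} (i′ , fi′≡x , i∼i′) (j′ , fj′≡x , j∼j′)
        with f-injective (trans fi′≡x (sym fj′≡x))
      ... | refl = i∼i′ ◅◅ Star.reverse (symm H′) j∼j′

      extend : ∀ {i k} y → Adj H′ i k → Label k y → Label i y
      extend (inj₁ r) i~k k∼r = i~k ◅ k∼r
      extend (inj₂ x) i~k (j , fj≡x , k∼j) = j , fj≡x , i~k ◅ k∼j

      touched-label : ∀ i → f i ∈ touched → ∃ λ y → y ∈ labels × Label i y
      touched-label i fi∈ = inj₂ (f i) , ∈-++⁺ʳ (List.map inj₁ rs) (∈-map⁺ inj₂ fi∈) , i , refl , Star.ε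

      walk : ∀ {i r} → r ∈ rs → Connected H i r → ∃ λ y → y ∈ labels × Label i y
      walk {i} r∈rs Star.ε = inj₁ i , ∈-++⁺ˡ (∈-map⁺ inj₁ r∈rs) , Star.ε
      walk {i} r∈rs (_◅_ {j = k} i~k k∼r)
        with f i Fin.≟ a | f i Fin.≟ b | f k Fin.≟ a | f k Fin.≟ b
      ... | yes fi≡a | _ | _ | _ = touched-label i (here fi≡a)
      ... | no _ | yes fi≡b | _ | _ = touched-label i (there (here fi≡b))
      ... | no _ | no _ | yes fk≡a | _ = touched-label i (adjacent⇒touched i~k (inj₁ fk≡a))
      ... | no _ | no _ | no _ | yes fk≡b = touched-label i (adjacent⇒touched i~k (inj₂ fk≡b))
      ... | no fi≢a | no fi≢b | no fk≢a | no fk≢b =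
        let y , y∈ , k-y = walk r∈rs k∼r
        in y , y∈ , extend y (subst₂ (Adj G) (sym (g≡f i fi≢a fi≢b)) (sym (g≡f k fk≢a fk≢b)) i~k) k-y

      label : ∀ i → ∃ λ y → y ∈ labels × Label i y
      label i = let r , r∈rs , i∼r = representative H i in walk r∈rs i∼r

  -- Arithmetic of squares and sums

  -- Every inequality between squares below is read off from this subtraction-free identity.
  ∣-∣²-expand : ∀ x y → ∣ x - y ∣ * ∣ x - y ∣ + 2 * (x * y) ≡ x * x + y * y
  ∣-∣²-expand x y with ℕ.≤-total x y
  ... | inj₁ x≤y with d , refl ← ℕ.m≤n⇒∃[o]m+o≡n x≤y
    rewrite ℕ.∣m-m+n∣≡n x d = expand x d
    where
    expand : ∀ x d → d * d + 2 * (x * (x + d)) ≡ x * x + (x + d) * (x + d)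
    expand = ℕ-Solver.solve-∀
  ... | inj₂ y≤x with d , refl ← ℕ.m≤n⇒∃[o]m+o≡n y≤x
    rewrite ℕ.∣-∣-comm (y + d) y | ℕ.∣m-m+n∣≡n y d = expand y d
    where
    expand : ∀ y d → d * d + 2 * ((y + d) * y) ≡ (y + d) * (y + d) + y * y
    expand = ℕ-Solver.solve-∀

  -- AM–GM.
  2*≤square+∣-∣² : ∀ l x y → 2 * l * x ≤ 2 * l * y + l * l + ∣ x - y ∣ * ∣ x - y ∣
  2*≤square+∣-∣² l x y = begin
    2 * l * x                            ≤⟨ ℕ.*-monoʳ-≤ (2 * l) (ℕ.m≤n+∣m-n∣ x y) ⟩
    2 * l * (y + d)                      ≡⟨ rearrange l y d ⟩
    2 * l * y + 2 * (l * d)              ≤⟨ ℕ.+-monoʳ-≤ (2 * l * y) (ℕ.m≤n+m (2 * (l * d)) (∣ l - d ∣ * ∣ l - d ∣)) ⟩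
    2 * l * y + (∣ l - d ∣ * ∣ l - d ∣ + 2 * (l * d)) ≡⟨ cong (2 * l * y +_) (∣-∣²-expand l d) ⟩
    2 * l * y + (l * l + d * d)          ≡⟨ ℕ.+-assoc (2 * l * y) (l * l) (d * d) ⟨
    2 * l * y + l * l + d * d            ∎
    where
    open ℕ.≤-Reasoning
    d = ∣ x - y ∣
    rearrange : ∀ l y d → 2 * l * (y + d) ≡ 2 * l * y + 2 * (l * d)
    rearrange = ℕ-Solver.solve-∀

  -- The two hypotheses bound `∣ x - y ∣` by `e`. In `variance` this compares the totals for two
  -- choices of the first vertex.
  squares-close : ∀ x y e → x ≤ y + e → y ≤ x + e → x * x + y * y ≤ 2 * (x * y) + e * e
  squares-close x y e x≤ y≤ = begin
    x * x + y * y                          ≡⟨ ∣-∣²-expand x y ⟨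
    ∣ x - y ∣ * ∣ x - y ∣ + 2 * (x * y)    ≤⟨ ℕ.+-monoˡ-≤ (2 * (x * y)) (ℕ.*-mono-≤ close close) ⟩
    e * e + 2 * (x * y)                    ≡⟨ ℕ.+-comm (e * e) (2 * (x * y)) ⟩
    2 * (x * y) + e * e                    ∎
    where
    open ℕ.≤-Reasoning
    close : ∣ x - y ∣ ≤ e
    close with ℕ.∣m-n∣≡[m∸n]∨[n∸m] x y
    ... | inj₁ eq = subst (_≤ e) (sym eq) (ℕ.m≤n+o⇒m∸n≤o x y x≤)
    ... | inj₂ eq = subst (_≤ e) (sym eq) (ℕ.m≤n+o⇒m∸n≤o y x y≤)

  square-sum : ∀ x y → (x + y) * (x + y) ≤ 2 * (x * x + y * y)
  square-sum x y = begin
    (x + y) * (x + y)                        ≡⟨ expand x y ⟩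
    2 * (x * y) + (x * x + y * y)            ≤⟨ ℕ.+-monoˡ-≤ (x * x + y * y) (ℕ.m≤n+m _ (∣ x - y ∣ * ∣ x - y ∣)) ⟩
    ∣ x - y ∣ * ∣ x - y ∣ + 2 * (x * y) + (x * x + y * y)
                                             ≡⟨ cong (_+ (x * x + y * y)) (∣-∣²-expand x y) ⟩
    x * x + y * y + (x * x + y * y)          ≡⟨ cong (x * x + y * y +_) (ℕ.+-identityʳ _) ⟨
    2 * (x * x + y * y)                      ∎
    where
    open ℕ.≤-Reasoning
    expand : ∀ x y → (x + y) * (x + y) ≡ 2 * (x * y) + (x * x + y * y)
    expand = ℕ-Solver.solve-∀

  ∑-mono : ∀ {n} {f g : Fin n → ℕ} → (∀ i → f i ≤ g i) → sum f ≤ sum g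
  ∑-mono {zero}  f≤g = z≤n
  ∑-mono {suc n} f≤g = ℕ.+-mono-≤ (f≤g zero) (∑-mono (f≤g ∘ suc))

  ∑-lookup-≤ : ∀ {n} (f : Fin n → ℕ) i → f i ≤ sum f
  ∑-lookup-≤ f zero    = ℕ.m≤m+n (f zero) _
  ∑-lookup-≤ f (suc i) = ℕ.≤-trans (∑-lookup-≤ (f ∘ suc) i) (ℕ.m≤n+m _ (f zero))

  ∑-const : ∀ n c → ∑[ _ < n ] c ≡ n * c
  ∑-const zero    c = refl
  ∑-const (suc n) c = cong (c +_) (∑-const n c)

  ∑-*-∑ : ∀ {m n} (f : Fin m → ℕ) (g : Fin n → ℕ) → sum f * sum g ≡ ∑[ i < m ] ∑[ j < n ] (f i * g j)
  ∑-*-∑ f g = trans (*-distribʳ-sum (sum g) f) (sum-cong-≗ λ i → *-distribˡ-sum (f i) g)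

  𝟙 : Bool → ℕ
  𝟙 true  = 1
  𝟙 false = 0

  ∑-≟ : ∀ {n} (a : Fin n) → ∑[ x < n ] 𝟙 (does (x Fin.≟ a)) ≡ 1
  ∑-≟ {suc n} zero    = cong suc (sum-replicate-zero n)
  ∑-≟ {suc n} (suc a) = ∑-≟ a

  module _ {n : ℕ} where

    -- Arrangements of a set of vertices

    infixl 6 _∖_
    _∖_ : (Fin n → Bool) → Fin n → Fin n → Bool
    (A ∖ a) x = A x ∧ not (does (x Fin.≟ a))

    ∖-self : ∀ A a → (A ∖ a) a ≡ false
    ∖-self A a rewrite dec-true (a Fin.≟ a) refl = ∧-zeroʳ (A a)

    ∖-other : ∀ A {a x} → x ≢ a → (A ∖ a) x ≡ A x
    ∖-other A {a} {x} x≢a rewrite dec-false (x Fin.≟ a) x≢a = ∧-identityʳ (A x)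

    ∖⇒≢ : ∀ A {a x} → (A ∖ a) x ≡ true → x ≢ a
    ∖⇒≢ A {a} p refl = contradiction (trans (sym p) (∖-self A a)) λ ()

    ∖⇒∈ : ∀ A {a x} → (A ∖ a) x ≡ true → A x ≡ true
    ∖⇒∈ A {a} {x} p = trans (sym (∖-other A (∖⇒≢ A p))) p

    card : (Fin n → Bool) → ℕ
    card A = ∑[ x < n ] 𝟙 (A x)

    card-∖ : ∀ A {a} → A a ≡ true → card A ≡ suc (card (A ∖ a))
    card-∖ A {a} Aa = begin
      card A                                                  ≡⟨ sum-cong-≗ split ⟩
      ∑[ x < n ] (𝟙 (does (x Fin.≟ a)) + 𝟙 ((A ∖ a) x))       ≡⟨ ∑-distrib-+ {n} _ _ ⟩
      ∑[ x < n ] 𝟙 (does (x Fin.≟ a)) + card (A ∖ a)          ≡⟨ cong (_+ card (A ∖ a)) (∑-≟ a) ⟩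
      suc (card (A ∖ a))                                      ∎
      where
      open ≡-Reasoning
      split : ∀ x → 𝟙 (A x) ≡ 𝟙 (does (x Fin.≟ a)) + 𝟙 ((A ∖ a) x)
      split x with x Fin.≟ a
      ... | yes refl rewrite Aa = refl
      ... | no _ = cong 𝟙 (sym (∧-identityʳ (A x)))

    -- Words of distinct elements of `A`. Deleting each letter from the set follows the recursion of
    -- `∑arr`, so hypotheses are required only of words that are summed over.
    Arrangement : ∀ {k} → (Fin n → Bool) → Vec (Fin n) k → Set
    Arrangement A []      = ⊤
    Arrangement A (a ∷ v) = A a ≡ true × Arrangement (A ∖ a) v

    -- The recursion conditions on the first vertex revealed.
    ∑arr : ∀ k → (Fin n → Bool) → (Vec (Fin n) k → ℕ) → ℕ
    ∑arr zero    A f = f []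
    ∑arr (suc k) A f = ∑[ a < n ] (𝟙 (A a) * ∑arr k (A ∖ a) (λ v → f (a ∷ v)))

    ∑arr-set-cong : ∀ k {A B} → A ≗ B → ∀ f → ∑arr k A f ≡ ∑arr k B f
    ∑arr-set-cong zero    A≗B f = refl
    ∑arr-set-cong (suc k) A≗B f = sum-cong-≗ λ a → cong₂ _*_ (cong 𝟙 (A≗B a))
      (∑arr-set-cong k (λ x → cong (_∧ not (does (x Fin.≟ a))) (A≗B x)) _)

    ∑arr-mono : ∀ k A {f g} → (∀ v → Arrangement A v → f v ≤ g v) → ∑arr k A f ≤ ∑arr k A g
    ∑arr-mono zero    A f≤g = f≤g [] tt
    ∑arr-mono (suc k) A {f} {g} f≤g = ∑-mono term
      where
      term : ∀ a → 𝟙 (A a) * ∑arr k (A ∖ a) (λ v → f (a ∷ v)) ≤ 𝟙 (A a) * ∑arr k (A ∖ a) (λ v → g (a ∷ v))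
      term a with A a in Aa
      ... | false = z≤n
      ... | true  = ℕ.+-mono-≤ (∑arr-mono k (A ∖ a) λ v v∈ → f≤g (a ∷ v) (Aa , v∈)) z≤n

    ∑arr-cong : ∀ k A {f g} → f ≗ g → ∑arr k A f ≡ ∑arr k A g
    ∑arr-cong k A f≗g = ℕ.≤-antisym
      (∑arr-mono k A λ v _ → ℕ.≤-reflexive (f≗g v))
      (∑arr-mono k A λ v _ → ℕ.≤-reflexive (sym (f≗g v)))

    ∑arr-+ : ∀ k A f g → ∑arr k A (λ v → f v + g v) ≡ ∑arr k A f + ∑arr k A g
    ∑arr-+ zero    A f g = refl
    ∑arr-+ (suc k) A f g = trans
      (sum-cong-≗ λ a → trans (cong (𝟙 (A a) *_) (∑arr-+ k (A ∖ a) (λ v → f (a ∷ v)) (λ v → g (a ∷ v)))) (ℕ.*-distribˡ-+ (𝟙 (A a)) (∑arr k (A ∖ a) (λ v → f (a ∷ v))) _))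
      (∑-distrib-+ {n} _ _)

    ∑arr-* : ∀ k A c f → ∑arr k A (λ v → c * f v) ≡ c * ∑arr k A f
    ∑arr-* zero    A c f = refl
    ∑arr-* (suc k) A c f = trans
      (sum-cong-≗ λ a → trans (cong (𝟙 (A a) *_) (∑arr-* k (A ∖ a) c _)) (swap (𝟙 (A a)) c _))
      (sym (*-distribˡ-sum {n} c _))
      where
      swap : ∀ x y z → x * (y * z) ≡ y * (x * z)
      swap = ℕ-Solver.solve-∀

    ∑arr-const : ∀ k A c → ∑arr k A (λ _ → c) ≡ c * ∑arr k A (λ _ → 1)
    ∑arr-const k A c = trans (∑arr-cong k A λ _ → sym (ℕ.*-identityʳ c)) (∑arr-* k A c (λ _ → 1))

    ∑arr-∑ : ∀ k A {m} (f : Fin m → Vec (Fin n) k → ℕ) →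
      ∑arr k A (λ v → ∑[ j < m ] f j v) ≡ ∑[ j < m ] ∑arr k A (f j)
    ∑arr-∑ k A {zero}  f = ∑arr-const k A 0
    ∑arr-∑ k A {suc m} f = trans (∑arr-+ k A _ _) (cong (∑arr k A (f zero) +_) (∑arr-∑ k A (f ∘ suc)))

    ∑arr-count : ∀ k A → card A ≡ k → ∑arr k A (λ _ → 1) ≡ k !
    ∑arr-count zero    A _       = refl
    ∑arr-count (suc k) A card≡k = begin
      ∑[ a < n ] (𝟙 (A a) * ∑arr k (A ∖ a) (λ _ → 1)) ≡⟨ sum-cong-≗ term ⟩
      ∑[ a < n ] (𝟙 (A a) * k !)                      ≡⟨ *-distribʳ-sum {n} (k !) _ ⟨
      card A * k !                                    ≡⟨ cong (_* k !) card≡k ⟩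
      suc k * k !                                     ∎
      where
      open ≡-Reasoning
      term : ∀ a → 𝟙 (A a) * ∑arr k (A ∖ a) (λ _ → 1) ≡ 𝟙 (A a) * k !
      term a with A a in Aa
      ... | false = refl
      ... | true  = cong (1 *_) (∑arr-count k (A ∖ a) (ℕ.suc-injective (trans (sym (card-∖ A Aa)) card≡k)))

    -- Substituting `π` a for a in each sum of the recursion pulls the set and the function back
    -- along `π`; injectivity of `π` makes this compatible with deleting a vertex.
    ∑arr-relabel : ∀ k A f (π : Perm.Permutation′ n) →
      ∑arr k A f ≡ ∑arr k (A ∘ (π ⟨$⟩ʳ_)) (f ∘ Vec.map (π ⟨$⟩ʳ_))
    ∑arr-relabel zero    A f π = refl
    ∑arr-relabel (suc k) A f π = trans
      (sum-permute _ π)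
      (sum-cong-≗ λ a → cong (𝟙 (A (π ⟨$⟩ʳ a)) *_) (trans
        (∑arr-relabel k (A ∖ (π ⟨$⟩ʳ a)) _ π)
        (∑arr-set-cong k (commute a) _)))
      where
      commute : ∀ a → (A ∖ (π ⟨$⟩ʳ a)) ∘ (π ⟨$⟩ʳ_) ≗ (A ∘ (π ⟨$⟩ʳ_)) ∖ a
      commute a x with x Fin.≟ a
      ... | yes refl = trans (∖-self A _) (sym (∧-zeroʳ _))
      ... | no x≢a   = trans (∖-other A (λ eq → x≢a (Injection.injective (↔⇒↣ π) eq))) (sym (∧-identityʳ _))

    -- Exchanges of two vertices and the variance bound

    exchange : Fin n → Fin n → Fin n → Fin n
    exchange a b x = Perm.transpose a b ⟨$⟩ʳ x

    exchange-≡ʳ : ∀ a b → exchange a b b ≡ a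
    exchange-≡ʳ a b with b Fin.≟ a
    ... | yes b≡a = b≡a
    ... | no  _ rewrite dec-true (b Fin.≟ b) refl = refl

    exchange-≢ : ∀ {a b x} → x ≢ a → x ≢ b → exchange a b x ≡ x
    exchange-≢ {a} {b} {x} x≢a x≢b rewrite dec-false (x Fin.≟ a) x≢a | dec-false (x Fin.≟ b) x≢b = refl

    -- The bounded-difference condition of the martingale argument. Since only elements of `A` are
    -- exchanged, it passes to tails: once the first vertex is removed from the set, no exchange
    -- moves it.
    SwapLipschitz : ∀ {k} → ℕ → (Fin n → Bool) → (Vec (Fin n) k → ℕ) → Set
    SwapLipschitz D A f = ∀ v → Arrangement A v → ∀ a b → A a ≡ true → A b ≡ true →
      f (Vec.map (exchange a b) v) ≤ f v + D

    swap-∖ : ∀ A {a b} → A a ≡ true → A b ≡ true → (A ∖ a) ∘ exchange a b ≗ A ∖ b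
    swap-∖ A {a} {b} Aa Ab x with x Fin.≟ b
    ... | yes refl = trans (cong (A ∖ a) (exchange-≡ʳ a x)) (trans (∖-self A a) (sym (∧-zeroʳ (A x))))
    ... | no x≢b with x Fin.≟ a
    ...   | yes refl = trans (∖-other A (x≢b ∘ sym)) (trans Ab (sym (trans (∧-identityʳ (A x)) Aa)))
    ...   | no x≢a rewrite dec-false (x Fin.≟ b) x≢b =
      trans (∖-other A x≢a) (sym (∧-identityʳ (A x)))

    -- This couples the continuations after a with those after b. For the constant function 1 it
    -- shows that both choices have equally many continuations.
    ∑arr-swap : ∀ k A {a b} → A a ≡ true → A b ≡ true → ∀ f →
      ∑arr k (A ∖ a) f ≡ ∑arr k (A ∖ b) (f ∘ Vec.map (exchange a b))
    ∑arr-swap k A {a} {b} Aa Ab f =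
      trans (∑arr-relabel k (A ∖ a) f (Perm.transpose a b)) (∑arr-set-cong k (swap-∖ A Aa Ab) _)

    -- Exchanging a and b turns an arrangement that starts with a into one that
    -- starts with b.
    first-vertex : ∀ {k A D f} → SwapLipschitz {suc k} D A f → ∀ {a b} → A a ≡ true → A b ≡ true →
      ∑arr k (A ∖ a) (λ v → f (a ∷ v)) ≤ ∑arr k (A ∖ b) (λ v → f (b ∷ v)) + D * ∑arr k (A ∖ b) (λ _ → 1)
    first-vertex {k} {A} {D} {f} lip {a} {b} Aa Ab = begin
      ∑arr k (A ∖ a) (λ v → f (a ∷ v))
        ≡⟨ ∑arr-swap k A Aa Ab _ ⟩
      ∑arr k (A ∖ b) (λ v → f (a ∷ Vec.map (exchange a b) v))
        ≤⟨ ∑arr-mono k (A ∖ b) (λ v v∈ → subst (λ x → f (x ∷ Vec.map (exchange a b) v) ≤ f (b ∷ v) + D)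
             (exchange-≡ʳ a b) (lip (b ∷ v) (Ab , v∈) a b Aa Ab)) ⟩
      ∑arr k (A ∖ b) (λ v → f (b ∷ v) + D)
        ≡⟨ ∑arr-+ k (A ∖ b) _ _ ⟩
      ∑arr k (A ∖ b) (λ v → f (b ∷ v)) + ∑arr k (A ∖ b) (λ _ → D)
        ≡⟨ cong (∑arr k (A ∖ b) (λ v → f (b ∷ v)) +_) (∑arr-const k (A ∖ b) D) ⟩
      ∑arr k (A ∖ b) (λ v → f (b ∷ v)) + D * ∑arr k (A ∖ b) (λ _ → 1) ∎
      where open ℕ.≤-Reasoning

    tail-lipschitz : ∀ {k A D f} → SwapLipschitz {suc k} D A f → ∀ {a} → A a ≡ true →
      SwapLipschitz D (A ∖ a) (λ v → f (a ∷ v))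
    tail-lipschitz {A = A} {D} {f} lip {a} Aa v v∈ b c b∈ c∈ =
      subst (λ x → f (x ∷ Vec.map (exchange b c) v) ≤ f (a ∷ v) + D)
        (exchange-≢ (λ a≡b → ∖⇒≢ A b∈ (sym a≡b)) (λ a≡c → ∖⇒≢ A c∈ (sym a≡c)))
        (lip (a ∷ v) (Aa , v∈) b c (∖⇒∈ A b∈) (∖⇒∈ A c∈))

    -- After division by twice the squared number of arrangements, this says that the variance is at
    -- most k D² / 2. Induction on k: for each pair of first vertices, the induction hypothesis
    -- bounds the variance given each of them, and `first-vertex` bounds the difference of the two
    -- conditional means by D, which accounts for one further D² / 2.
    variance : ∀ k A D f → SwapLipschitz {k} D A f →
      2 * (∑arr k A (λ _ → 1) * ∑arr k A (λ v → f v * f v))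
        ≤ 2 * (∑arr k A f * ∑arr k A f) + k * (D * D) * (∑arr k A (λ _ → 1) * ∑arr k A (λ _ → 1))
    variance zero A D f lip = ℕ.≤-reflexive (base (f []) )
      where
      base : ∀ x → 2 * (1 * (x * x)) ≡ 2 * (x * x) + 0
      base = ℕ-Solver.solve-∀
    -- Doubling makes room for a copy of the double sum with a and b interchanged, so that each pair
    -- contributes an expression symmetric in its two first vertices.
    variance (suc k) A D f lip = ℕ.*-cancelˡ-≤ 2 (begin
      2 * (2 * (sum M * sum Y))
        ≡⟨ double (sum M * sum Y) ⟩
      2 * (sum M * sum Y + sum M * sum Y)
        ≡⟨ cong (2 *_) (cong₂ _+_ (∑-*-∑ M Y) (trans (∑-*-∑ M Y) (∑-comm {n} {n} _))) ⟩
      2 * (∑[ a < n ] ∑[ b < n ] (M a * Y b) + ∑[ a < n ] ∑[ b < n ] (M b * Y a))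
        ≡⟨ cong (2 *_) (∑∑-+ _ _) ⟨
      2 * ∑[ a < n ] ∑[ b < n ] (M a * Y b + M b * Y a)
        ≡⟨ ∑∑-* 2 _ ⟨
      ∑[ a < n ] ∑[ b < n ] (2 * (M a * Y b + M b * Y a))
        ≤⟨ ∑-mono (λ a → ∑-mono (λ b → pair a b)) ⟩
      ∑[ a < n ] ∑[ b < n ] (4 * (X a * X b) + c * (M a * M b))
        ≡⟨ ∑∑-+ _ _ ⟩
      ∑[ a < n ] ∑[ b < n ] (4 * (X a * X b)) + ∑[ a < n ] ∑[ b < n ] (c * (M a * M b))
        ≡⟨ cong₂ _+_ (∑∑-* 4 _) (∑∑-* c _) ⟩
      4 * ∑[ a < n ] ∑[ b < n ] (X a * X b) + c * ∑[ a < n ] ∑[ b < n ] (M a * M b)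
        ≡⟨ cong₂ _+_ (cong (4 *_) (sym (∑-*-∑ X X))) (cong (c *_) (sym (∑-*-∑ M M))) ⟩
      4 * (sum X * sum X) + c * (sum M * sum M)
        ≡⟨ collect (sum X * sum X) (suc k * (D * D)) (sum M * sum M) ⟩
      2 * (2 * (sum X * sum X) + suc k * (D * D) * (sum M * sum M)) ∎)
      where
      open ℕ.≤-Reasoning
      c = 2 * (suc k * (D * D))
      m x y M X Y : Fin n → ℕ
      m a = ∑arr k (A ∖ a) (λ _ → 1)
      x a = ∑arr k (A ∖ a) (λ v → f (a ∷ v))
      y a = ∑arr k (A ∖ a) (λ v → f (a ∷ v) * f (a ∷ v))
      M a = 𝟙 (A a) * m a
      X a = 𝟙 (A a) * x a
      Y a = 𝟙 (A a) * y a

      double : ∀ z → 2 * (2 * z) ≡ 2 * (z + z)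
      double = ℕ-Solver.solve-∀
      collect : ∀ u d w → 4 * u + 2 * d * w ≡ 2 * (2 * u + d * w)
      collect = ℕ-Solver.solve-∀
      ∑∑-+ : (g h : Fin n → Fin n → ℕ) → ∑[ a < n ] ∑[ b < n ] (g a b + h a b)
        ≡ ∑[ a < n ] ∑[ b < n ] g a b + ∑[ a < n ] ∑[ b < n ] h a b
      ∑∑-+ g h = trans (sum-cong-≗ λ a → ∑-distrib-+ (g a) (h a)) (∑-distrib-+ {n} _ _)
      ∑∑-* : ∀ z (g : Fin n → Fin n → ℕ) → ∑[ a < n ] ∑[ b < n ] (z * g a b)
        ≡ z * ∑[ a < n ] ∑[ b < n ] g a b
      ∑∑-* z g = trans (sum-cong-≗ λ a → sym (*-distribˡ-sum z (g a))) (sym (*-distribˡ-sum {n} z _))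

      -- Here μ is the common number of continuations after a and after b, and e is D². The two
      -- induction hypotheses contribute 2 k e and `close` contributes 2 e.
      arith : ∀ μ xa xb ya yb e →
        2 * (μ * ya) ≤ 2 * (xa * xa) + k * e * (μ * μ) →
        2 * (μ * yb) ≤ 2 * (xb * xb) + k * e * (μ * μ) →
        xa * xa + xb * xb ≤ 2 * (xa * xb) + e * (μ * μ) →
        2 * (μ * yb + μ * ya) ≤ 4 * (xa * xb) + 2 * (suc k * e) * (μ * μ)
      arith μ xa xb ya yb e ha hb close = begin
        2 * (μ * yb + μ * ya)
          ≡⟨ dist (μ * ya) (μ * yb) ⟩
        2 * (μ * ya) + 2 * (μ * yb)
          ≤⟨ ℕ.+-mono-≤ ha hb ⟩
        (2 * (xa * xa) + k * e * (μ * μ)) + (2 * (xb * xb) + k * e * (μ * μ))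
          ≡⟨ regroup (xa * xa) (xb * xb) (k * e) (μ * μ) ⟩
        2 * (xa * xa + xb * xb) + 2 * (k * e) * (μ * μ)
          ≤⟨ ℕ.+-monoˡ-≤ (2 * (k * e) * (μ * μ)) (ℕ.*-monoʳ-≤ 2 close) ⟩
        2 * (2 * (xa * xb) + e * (μ * μ)) + 2 * (k * e) * (μ * μ)
          ≡⟨ finish (xa * xb) e k (μ * μ) ⟩
        4 * (xa * xb) + 2 * (suc k * e) * (μ * μ) ∎
        where
        dist : ∀ p q → 2 * (q + p) ≡ 2 * p + 2 * q
        dist = ℕ-Solver.solve-∀
        regroup : ∀ p q r s → (2 * p + r * s) + (2 * q + r * s) ≡ 2 * (p + q) + 2 * r * s
        regroup = ℕ-Solver.solve-∀
        finish : ∀ p e k s → 2 * (2 * p + e * s) + 2 * (k * e) * s ≡ 4 * p + 2 * ((1 + k) * e) * s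
        finish = ℕ-Solver.solve-∀

      pair : ∀ a b → 2 * (M a * Y b + M b * Y a) ≤ 4 * (X a * X b) + c * (M a * M b)
      pair a b with A a in Aa | A b in Ab
      ... | false | false = z≤n
      ... | false | true  = ℕ.≤-trans (ℕ.≤-reflexive (cong (2 *_) (ℕ.*-zeroʳ (1 * m b)))) z≤n
      ... | true  | false = ℕ.≤-trans (ℕ.≤-reflexive (cong (2 *_) (trans (ℕ.+-identityʳ _) (ℕ.*-zeroʳ (1 * m a))))) z≤n
      ... | true  | true  rewrite ℕ.*-identityˡ (m a) | ℕ.*-identityˡ (m b) | ℕ.*-identityˡ (x a) | ℕ.*-identityˡ (x b)
                                | ℕ.*-identityˡ (y a) | ℕ.*-identityˡ (y b) =
        subst (λ μ → 2 * (m a * y b + μ * y a) ≤ 4 * (x a * x b) + c * (m a * μ)) ma≡mb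
          (arith (m a) (x a) (x b) (y a) (y b) (D * D)
            (variance k (A ∖ a) D _ (tail-lipschitz {f = f} lip Aa))
            (subst (λ μ → 2 * (μ * y b) ≤ 2 * (x b * x b) + k * (D * D) * (μ * μ)) (sym ma≡mb)
              (variance k (A ∖ b) D _ (tail-lipschitz {f = f} lip Ab)))
            (subst (λ z → x a * x a + x b * x b ≤ 2 * (x a * x b) + z) (sq D (m a))
              (squares-close (x a) (x b) (D * m a)
                (subst (λ μ → x a ≤ x b + D * μ) (sym ma≡mb) (first-vertex {f = f} lip Aa Ab))
                (first-vertex {f = f} lip Ab Aa))))
        where
        ma≡mb : m a ≡ m b
        ma≡mb = ∑arr-swap k A Aa Ab _
        sq : ∀ d z → (d * z) * (d * z) ≡ d * d * (z * z)
        sq = ℕ-Solver.solve-∀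

  -- From permutations to arrangements

  everything : ∀ {n} → Fin n → Bool
  everything _ = true

  module _ {n : ℕ} where

    arrangement⇒unique : ∀ {k} A {v : Vec (Fin n) k} → Arrangement A v →
      All (λ x → A x ≡ true) v × Unique v
    arrangement⇒unique A {[]}    _ = [] , []
    arrangement⇒unique A {a ∷ v} (Aa , arr) =
      let v∈ , v! = arrangement⇒unique (A ∖ a) arr
      in Aa ∷ All.map (∖⇒∈ A) v∈ , All.map (λ x∈ → ≢-sym (∖⇒≢ A x∈)) v∈ ∷ v!

    unique⇒arrangement : ∀ {k} A {v : Vec (Fin n) k} → All (λ x → A x ≡ true) v → Unique v →
      Arrangement A v
    unique⇒arrangement A []        []         = tt
    unique⇒arrangement A (Aa ∷ v∈) (a∉v ∷ v!) = Aa , unique⇒arrangement _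
      (All.map (λ (x∈ , a≢x) → trans (∖-other A (≢-sym a≢x)) x∈) (All.zip (v∈ , a∉v))) v!

    arrangement? : ∀ {k} A (v : Vec (Fin n) k) → Dec (Arrangement A v)
    arrangement? A []      = yes tt
    arrangement? A (a ∷ v) = (A a Bool.≟ true) ×-dec arrangement? (A ∖ a) v

    unique⇔arrangement : ∀ {k} {v : Vec (Fin n) k} → Unique v ⇔ Arrangement everything v
    unique⇔arrangement {v = v} = mk⇔
      (unique⇒arrangement everything (All.universal (λ _ → refl) v))
      (proj₂ ∘ arrangement⇒unique everything)

  sum-allFin : ∀ n (f : Fin n → ℕ) → ListAction.sum (map f (allFin n)) ≡ sum f
  sum-allFin n f = trans (cong ListAction.sum (map-tabulate id f)) (sum-tabulate n f)
    where
    sum-tabulate : ∀ n (f : Fin n → ℕ) → ListAction.sum (tabulate f) ≡ sum f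
    sum-tabulate zero    f = refl
    sum-tabulate (suc n) f = cong (f zero +_) (sum-tabulate n (f ∘ suc))

  sum-cartesianProductWith : ∀ {A B C : Set} (h : C → ℕ) (f : A → B → C) xs ys →
    ListAction.sum (map h (cartesianProductWith f xs ys))
      ≡ ListAction.sum (map (λ x → ListAction.sum (map (λ y → h (f x y)) ys)) xs)
  sum-cartesianProductWith h f []       ys = refl
  sum-cartesianProductWith h f (x ∷ xs) ys = begin
    ListAction.sum (map h (map (f x) ys ++ cartesianProductWith f xs ys))
      ≡⟨ cong ListAction.sum (map-++ h (map (f x) ys) _) ⟩
    ListAction.sum (map h (map (f x) ys) ++ map h (cartesianProductWith f xs ys))
      ≡⟨ sum-++ (map h (map (f x) ys)) _ ⟩
    ListAction.sum (map h (map (f x) ys)) + ListAction.sum (map h (cartesianProductWith f xs ys))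
      ≡⟨ cong₂ _+_ (cong ListAction.sum (sym (map-∘ ys))) (sum-cartesianProductWith h f xs ys) ⟩
    _ ∎
    where open ≡-Reasoning

  sum-map-mono : ∀ {A : Set} c (f g : A → ℕ) → (∀ x → c * f x ≤ g x) → ∀ xs →
    c * ListAction.sum (map f xs) ≤ ListAction.sum (map g xs)
  sum-map-mono c f g cf≤g []       = ℕ.≤-reflexive (ℕ.*-zeroʳ c)
  sum-map-mono c f g cf≤g (x ∷ xs) = ℕ.≤-trans
    (ℕ.≤-reflexive (ℕ.*-distribˡ-+ c (f x) _))
    (ℕ.+-mono-≤ (cf≤g x) (sum-map-mono c f g cf≤g xs))

  -- `words` also lists words with repeated letters; the indicator removes them, and splitting off
  -- the first letter reproduces the recursion of `∑arr`.
  sum-words : ∀ {n} k A (f : Vec (Fin n) k → ℕ) →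
    ListAction.sum (map (λ v → 𝟙 (does (arrangement? A v)) * f v) (words (allFin n) k)) ≡ ∑arr k A f
  sum-words zero A f = trans (ℕ.+-identityʳ _) (ℕ.*-identityˡ (f []))
  sum-words {n} (suc k) A f = begin
    ListAction.sum (map h (cartesianProductWith _∷_ (allFin n) (words (allFin n) k)))
      ≡⟨ sum-cartesianProductWith h _∷_ (allFin n) (words (allFin n) k) ⟩
    ListAction.sum (map (λ a → ListAction.sum (map (λ v → h (a ∷ v)) (words (allFin n) k))) (allFin n))
      ≡⟨ sum-allFin n _ ⟩
    ∑[ a < n ] ListAction.sum (map (λ v → h (a ∷ v)) (words (allFin n) k))
      ≡⟨ sum-cong-≗ first ⟩
    ∑arr (suc k) A f ∎
    where
    open ≡-Reasoning
    h : Vec (Fin n) (suc k) → ℕ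
    h v = 𝟙 (does (arrangement? A v)) * f v
    sum-zero : ∀ {A : Set} (xs : List A) → ListAction.sum (map (λ _ → 0) xs) ≡ 0
    sum-zero []       = refl
    sum-zero (_ ∷ xs) = sum-zero xs
    first : ∀ a → ListAction.sum (map (λ v → h (a ∷ v)) (words (allFin n) k))
      ≡ 𝟙 (A a) * ∑arr k (A ∖ a) (λ v → f (a ∷ v))
    first a with A a
    ... | false = sum-zero (words (allFin n) k)
    ... | true  = trans (sum-words k (A ∖ a) (λ v → f (a ∷ v))) (sym (ℕ.*-identityˡ _))

  sum-permutations : ∀ N (f : Vec (Fin N) N → ℕ) →
    ListAction.sum (map (f ∘ vertices) (permutations N)) ≡ ∑arr N everything f
  sum-permutations N f = trans (filtered (words (allFin N) N)) (sum-words N everything f)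
    where
    filtered : ∀ ws → ListAction.sum (map (f ∘ vertices) (mapMaybe toPermutation ws))
      ≡ ListAction.sum (map (λ v → 𝟙 (does (arrangement? everything v)) * f v) ws)
    filtered []       = refl
    filtered (w ∷ ws)
      -- Both decisions have the same boolean, so one case split settles the filter in
      -- `toPermutation` and the indicator alike.
      rewrite sym (does-⇔ (unique⇔arrangement {v = w})
                (allPairs? (λ x y → ¬? (x Fin.≟ y)) w) (arrangement? everything w))
      with allPairs? (λ x y → ¬? (x Fin.≟ y)) w
    ... | yes _ = cong₂ _+_ (sym (ℕ.*-identityˡ (f w))) (filtered ws)
    ... | no  _ = filtered ws

  card-everything : ∀ n → card (everything {n}) ≡ n
  card-everything zero    = refl
  card-everything (suc n) = cong suc (card-everything n)

  arrangements-count : ∀ N → ∑arr N (everything {N}) (λ _ → 1) ≡ N !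
  arrangements-count N = ∑arr-count N everything (card-everything N)

  -- Deviations from the mean and the maximum of several functions

  module _ {n : ℕ} (k : ℕ) (A : Fin n → Bool) where

    private
      m = ∑arr k A (λ _ → 1)

    -- The deviation of `f` from its mean is multiplied by the number m of arrangements to clear the
    -- denominator. The sum of its squares is m² S₂ - m S², to which `variance`, multiplied by m,
    -- applies.
    ∑arr-deviation : ∀ D f → SwapLipschitz {k = k} D A f →
      2 * ∑arr k A (λ v → ∣ m * f v - ∑arr k A f ∣ * ∣ m * f v - ∑arr k A f ∣) ≤ k * (D * D) * (m * (m * m))
    ∑arr-deviation D f lip = ℕ.+-cancelʳ-≤ (2 * (m * (S * S))) _ _ (begin
      2 * Z + 2 * (m * (S * S))            ≡⟨ ℕ.*-distribˡ-+ 2 Z (m * (S * S)) ⟨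
      2 * (Z + m * (S * S))                ≡⟨ cong (2 *_) second-moment ⟩
      2 * (m * m * S₂)                     ≡⟨ pull m S₂ ⟩
      m * (2 * (m * S₂))                   ≤⟨ ℕ.*-monoʳ-≤ m (variance k A D f lip) ⟩
      m * (2 * (S * S) + k * (D * D) * (m * m)) ≡⟨ push m (S * S) (k * (D * D)) ⟩
      k * (D * D) * (m * (m * m)) + 2 * (m * (S * S)) ∎)
      where
      open ℕ.≤-Reasoning
      S = ∑arr k A f
      S₂ = ∑arr k A (λ v → f v * f v)
      z : Vec (Fin n) k → ℕ
      z v = ∣ m * f v - S ∣ * ∣ m * f v - S ∣
      Z = ∑arr k A z

      pull : ∀ m s → 2 * (m * m * s) ≡ m * (2 * (m * s))
      pull = ℕ-Solver.solve-∀
      push : ∀ m s e → m * (2 * s + e * (m * m)) ≡ e * (m * (m * m)) + 2 * (m * s)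
      push = ℕ-Solver.solve-∀
      cross : ∀ m x s → 2 * (m * x * s) ≡ 2 * (m * s) * x
      cross = ℕ-Solver.solve-∀
      square : ∀ m x → m * x * (m * x) ≡ m * m * (x * x)
      square = ℕ-Solver.solve-∀
      regroup : ∀ z m s → z + m * (s * s) + m * (s * s) ≡ z + 2 * (m * s) * s
      regroup = ℕ-Solver.solve-∀

      second-moment : Z + m * (S * S) ≡ m * m * S₂
      -- The cross terms sum to 2 m S², of which one copy cancels against the sum of the constant
      -- S².
      second-moment = ℕ.+-cancelʳ-≡ (m * (S * S)) _ _ (begin-equality
        Z + m * (S * S) + m * (S * S)
          ≡⟨ regroup Z m S ⟩
        Z + 2 * (m * S) * S
          ≡⟨ cong (Z +_) (∑arr-* k A (2 * (m * S)) f) ⟨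
        Z + ∑arr k A (λ v → 2 * (m * S) * f v)
          ≡⟨ ∑arr-+ k A z _ ⟨
        ∑arr k A (λ v → z v + 2 * (m * S) * f v)
          ≡⟨ ∑arr-cong k A (λ v → trans (cong (z v +_) (sym (cross m (f v) S))) (trans (∣-∣²-expand (m * f v) S) (cong (_+ S * S) (square m (f v))))) ⟩
        ∑arr k A (λ v → m * m * (f v * f v) + S * S)
          ≡⟨ ∑arr-+ k A _ _ ⟩
        ∑arr k A (λ v → m * m * (f v * f v)) + ∑arr k A (λ _ → S * S)
          ≡⟨ cong₂ _+_ (∑arr-* k A (m * m) _) (trans (∑arr-const k A (S * S)) (ℕ.*-comm (S * S) m)) ⟩
        m * m * S₂ + m * (S * S) ∎)

  -- Divided by 4 l N!, the bound on the mean of X is B / N! + s + l / 2 + K N D² / (4 l): the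
  -- rounding error s, and AM-GM applied to the deviation of the `f` j that is close to X. As j
  -- depends on σ, the squared deviations are summed over all j.
  maximal-bound : ∀ {K} N D s l B (f : Fin K → Vec (Fin N) N → ℕ) →
    (∀ j → SwapLipschitz D everything (f j)) →
    (∀ j → ∑arr N everything (f j) ≤ B) →
    (X : Permutation N → ℕ) → (∀ σ → ∃ λ j → X σ ≤ f j (vertices σ) + s) →
    4 * l * ListAction.sum (map X (permutations N))
      ≤ 4 * l * B + N ! * (4 * l * s + 2 * (l * l) + K * (N * (D * D)))
  maximal-bound {K} N D s l B f lip f≤B X X≤ =
    ℕ.*-cancelˡ-≤ (m * m) {{ℕ.m*n≢0 m m}} (begin
      m * m * (4 * l * T)
        ≡⟨ rearrange₁ m l T ⟩
      2 * (2 * (m * l) * m * T)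
        ≤⟨ ℕ.*-monoʳ-≤ 2 (sum-map-mono (2 * (m * l) * m) X (Φ ∘ vertices) pointwise (permutations N)) ⟩
      2 * ListAction.sum (map (Φ ∘ vertices) (permutations N))
        ≡⟨ cong (2 *_) (sum-permutations N Φ) ⟩
      2 * ∑arr N everything Φ
        ≡⟨ cong (2 *_) (trans (∑arr-+ N everything _ _) (cong₂ _+_
             (trans (∑arr-const N everything c) (cong (c *_) (arrangements-count N)))
             (∑arr-∑ N everything z))) ⟩
      2 * (c * m + ∑[ j < K ] ∑arr N everything (z j))
        ≡⟨ trans (ℕ.*-distribˡ-+ 2 (c * m) _) (cong (2 * (c * m) +_) (*-distribˡ-sum {K} 2 _)) ⟩
      2 * (c * m) + ∑[ j < K ] (2 * ∑arr N everything (z j))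
        ≤⟨ ℕ.+-monoʳ-≤ (2 * (c * m)) (∑-mono deviation) ⟩
      2 * (c * m) + ∑[ j < K ] (N * (D * D) * (m * (m * m)))
        ≡⟨ cong (2 * (c * m) +_) (∑-const K _) ⟩
      2 * (c * m) + K * (N * (D * D) * (m * (m * m)))
        ≡⟨ rearrange₂ m l s B K (N * (D * D)) ⟩
      m * m * (4 * l * B + m * (4 * l * s + 2 * (l * l) + K * (N * (D * D)))) ∎)
    where
    open ℕ.≤-Reasoning
    m = N !
    T = ListAction.sum (map X (permutations N))
    instance
      m≢0 : NonZero m
      m≢0 = N ℕ.!≢0
    S : Fin K → ℕ
    S j = ∑arr N everything (f j)
    z : Fin K → Vec (Fin N) N → ℕ
    z j v = ∣ m * f j v - S j ∣ * ∣ m * f j v - S j ∣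
    -- All quantities carry the factor m that clears the means, so AM-GM is applied with m l in
    -- place of l; `c` collects the terms free of σ.
    c = 2 * (m * l) * (B + m * s) + m * l * (m * l)
    Φ : Vec (Fin N) N → ℕ
    Φ v = c + ∑[ j < K ] z j v

    rearrange₁ : ∀ m l T → m * m * (4 * l * T) ≡ 2 * (2 * (m * l) * m * T)
    rearrange₁ = ℕ-Solver.solve-∀
    rearrange₂ : ∀ m l s B K e →
      2 * ((2 * (m * l) * (B + m * s) + m * l * (m * l)) * m) + K * (e * (m * (m * m)))
        ≡ m * m * (4 * l * B + m * (4 * l * s + 2 * (l * l) + K * e))
    rearrange₂ = ℕ-Solver.solve-∀
    rearrange₃ : ∀ l m x s → 2 * l * m * (x + s) ≡ 2 * l * (m * x) + 2 * l * (m * s)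
    rearrange₃ = ℕ-Solver.solve-∀
    rearrange₄ : ∀ l b w z → 2 * l * b + l * l + z + 2 * l * w ≡ 2 * l * (b + w) + l * l + z
    rearrange₄ = ℕ-Solver.solve-∀

    pointwise : ∀ σ → 2 * (m * l) * m * X σ ≤ Φ (vertices σ)
    pointwise σ with j , Xσ≤ ← X≤ σ = begin
      2 * (m * l) * m * X σ
        ≤⟨ ℕ.*-monoʳ-≤ (2 * (m * l) * m) Xσ≤ ⟩
      2 * (m * l) * m * (f j v + s)
        ≡⟨ rearrange₃ (m * l) m (f j v) s ⟩
      2 * (m * l) * (m * f j v) + 2 * (m * l) * (m * s)
        ≤⟨ ℕ.+-monoˡ-≤ (2 * (m * l) * (m * s)) (2*≤square+∣-∣² (m * l) (m * f j v) (S j)) ⟩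
      2 * (m * l) * S j + m * l * (m * l) + z j v + 2 * (m * l) * (m * s)
        ≡⟨ rearrange₄ (m * l) (S j) (m * s) (z j v) ⟩
      2 * (m * l) * (S j + m * s) + m * l * (m * l) + z j v
        ≤⟨ ℕ.+-mono-≤ (ℕ.+-monoˡ-≤ (m * l * (m * l)) (ℕ.*-monoʳ-≤ (2 * (m * l)) (ℕ.+-monoˡ-≤ (m * s) (f≤B j))))
                      (∑-lookup-≤ (λ j → z j v) j) ⟩
      Φ v ∎
      where v = vertices σ

    deviation : ∀ j → 2 * ∑arr N everything (z j) ≤ N * (D * D) * (m * (m * m))
    deviation j = subst
      (λ m → 2 * ∑arr N everything (λ v → ∣ m * f j v - S j ∣ * ∣ m * f j v - S j ∣) ≤ N * (D * D) * (m * (m * m)))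
      (arrangements-count N) (∑arr-deviation N everything D (f j) (lip j))

  -- Components of an initial segment of the permutation

  module _ {N} (G : Graph N) where

    -- At length t + 1 this is `C̃` by definition. Lengths are natural numbers with an irrelevant
    -- bound, so that induction on them involves no transport of proofs.
    prefixComponents : ∀ m → .(m ≤ N) → Vec (Fin N) N → ℕ
    prefixComponents m m≤N v = components (induced G (λ i → lookup v (inject≤ i m≤N)))

    prefixComponents-suc : ∀ m .(m<N : m < N) v →
      prefixComponents (suc m) m<N v ≤ suc (prefixComponents m (ℕ.<⇒≤ m<N) v)
    prefixComponents-suc m m<N v = ℕ.≤-trans
      (components-extend (induced G _) (induced G _) inject₁ (Fin.fromℕ m ∷ [])
        (λ {i} {j} → subst₂ (λ x y → Adj G (lookup v x) (lookup v y)) (shift i) (shift j)) cover)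
      (ℕ.≤-reflexive (ℕ.+-comm _ 1))
      where
      shift : ∀ i → inject≤ i (ℕ.<⇒≤ m<N) ≡ inject≤ (inject₁ i) m<N
      shift i = toℕ-injective (trans (toℕ-inject≤ i _) (sym (trans (toℕ-inject≤ (inject₁ i) _) (toℕ-inject₁ i))))
      cover : ∀ (i : Fin (suc m)) → (∃ λ j → i ≡ inject₁ j) ⊎ i ∈ Fin.fromℕ m ∷ []
      cover i with view i
      ... | ‵fromℕ     = inj₂ (here refl)
      ... | ‵inject₁ j = inj₁ (j , refl)

    prefixComponents-+ : ∀ d m .(d+m≤N : d + m ≤ N) v →
      prefixComponents (d + m) d+m≤N v ≤ prefixComponents m (ℕ.≤-trans (ℕ.m≤n+m m d) d+m≤N) v + d
    prefixComponents-+ zero    m d+m≤N v = ℕ.≤-reflexive (sym (ℕ.+-identityʳ _))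
    prefixComponents-+ (suc d) m d+m≤N v = ℕ.≤-trans (prefixComponents-suc (d + m) d+m≤N v)
      (ℕ.≤-trans (s≤s (prefixComponents-+ d m (ℕ.<⇒≤ d+m≤N) v)) (ℕ.≤-reflexive (sym (ℕ.+-suc _ d))))

    -- Only growth is controlled: a new vertex adds at most one component but may merge many. This
    -- suffices because times are rounded down to the grid.
    prefixComponents-mono : ∀ {m m′} .(m≤N : m ≤ N) .(m′≤N : m′ ≤ N) s v → m ≤ m′ → m′ ≤ s + m →
      prefixComponents m′ m′≤N v ≤ prefixComponents m m≤N v + s
    prefixComponents-mono {m} {m′} m≤N m′≤N s v m≤m′ m′≤s+m = helper (m′ ∸ m) (sym (ℕ.m∸n+n≡m m≤m′)) m′≤N m′≤s+m
      where
      -- Generalising m′ allows its equation with d + m to be matched by `refl`.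
      helper : ∀ {m′} d → m′ ≡ d + m → .(m′≤N : m′ ≤ N) → m′ ≤ s + m →
        prefixComponents m′ m′≤N v ≤ prefixComponents m m≤N v + s
      helper d refl m′≤N d+m≤s+m =
        ℕ.≤-trans (prefixComponents-+ d m m′≤N v) (ℕ.+-monoʳ-≤ _ (ℕ.+-cancelʳ-≤ m d s d+m≤s+m))

    -- Distinctness of the arranged vertices supplies the injectivity that `components-perturb` asks
    -- of the old embedding.
    prefixComponents-lipschitz : ∀ m .(m≤N : m ≤ N) →
      SwapLipschitz (2 * suc (maxDegree G)) everything (prefixComponents m m≤N)
    prefixComponents-lipschitz m m≤N v arr a b _ _ = components-perturb G a b _ _
      (λ {i} {j} eq → inject≤-injective m≤N m≤N i j
        (lookup-injective (proj₂ (arrangement⇒unique everything arr)) _ _ eq))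
      (λ i ≢a ≢b → trans (lookup-map (inject≤ i m≤N) (exchange a b) v) (exchange-≢ ≢a ≢b))

  -- Maxima over a grid of times

  -- s ≈ N / 4q is the mesh of the grid and l ≈ N / 2q the scale of the
  -- deviations.
  grid-arithmetic : ∀ N q E .{{_ : NonZero q}} → 2 ≤ q → 4 * q ≤ N →
    4 * (q * q) * (q * q) * E ≤ N →
    ∃ λ s → ∃ λ l → NonZero s × N ≤ 4 * q * s × NonZero l ×
      q * (4 * l * s + 2 * (l * l) + 4 * q * (N * E)) ≤ 4 * l * N
  grid-arithmetic N q E 2≤q 4q≤N q⁴E≤N = suc s′ , l , _ , N≤4qs , l≢0 , (begin
      q * (4 * l * suc s′ + 2 * (l * l) + 4 * q * (N * E))
        ≡⟨ rearrange q l s′ N E ⟩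
      -- The summands come from the mesh, from rounding it up by one, from the square in AM-GM and
      -- from the variance; each is at most l N.
      l * (s′ * (4 * q)) + l * (4 * q) + l * (l * (2 * q)) + N * P
        ≤⟨ ℕ.+-mono-≤ (ℕ.+-mono-≤ (ℕ.+-mono-≤ (ℕ.*-monoʳ-≤ l (ℕ.m/n*n≤m N (4 * q))) (ℕ.*-monoʳ-≤ l 4q≤N))
             (ℕ.*-monoʳ-≤ l (ℕ.m/n*n≤m N (2 * q)))) (ℕ.*-monoʳ-≤ N P≤l) ⟩
      l * N + l * N + l * N + N * l
        ≡⟨ collect l N ⟩
      4 * l * N ∎)
    where
    open ℕ.≤-Reasoning
    instance
      2q≢0 : NonZero (2 * q)
      2q≢0 = ℕ.m*n≢0 2 q
      4q≢0 : NonZero (4 * q)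
      4q≢0 = ℕ.m*n≢0 4 q
    s′ = N ℕ./ (4 * q)
    l = N ℕ./ (2 * q)
    P = 4 * (q * q) * E
    <suc/ : ∀ d .{{_ : NonZero d}} → N < d * suc (N ℕ./ d)
    <suc/ d = begin-strict
      N                 ≡⟨ ℕ.m≡m%n+[m/n]*n N d ⟩
      N ℕ.% d + N ℕ./ d * d <⟨ ℕ.+-monoˡ-< (N ℕ./ d * d) (ℕ.m%n<n N d) ⟩
      d + N ℕ./ d * d     ≡⟨ ℕ.*-comm d (suc (N ℕ./ d)) ⟨
      d * suc (N ℕ./ d)   ∎
    N≤4qs : N ≤ 4 * q * suc s′
    N≤4qs = ℕ.<⇒≤ (<suc/ (4 * q))
    l≢0 : NonZero l
    l≢0 = ℕ.>-nonZero (ℕ.*-cancelˡ-< (2 * q) 0 l (ℕ.+-cancelˡ-< (2 * q) _ _ (begin-strict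
      2 * q + 2 * q * 0 ≡⟨ zeroʳ q ⟩
      2 * q             ≤⟨ ℕ.*-monoˡ-≤ q (s≤s (s≤s (z≤n {2}))) ⟩
      4 * q             ≤⟨ 4q≤N ⟩
      N                 <⟨ <suc/ (2 * q) ⟩
      2 * q * suc l     ≡⟨ ℕ.*-suc (2 * q) l ⟩
      2 * q + 2 * q * l ∎)))
      where
      zeroʳ : ∀ q → 2 * q + 2 * q * 0 ≡ 2 * q
      zeroʳ = ℕ-Solver.solve-∀
    P≤l : P ≤ l
    -- Replacing 2 q by q², as 2 ≤ q permits, leaves the factor q² on both sides to cancel.
    P≤l = ℕ.s≤s⁻¹ (ℕ.*-cancelˡ-< (q * q) P (suc l) (begin-strict
      q * q * P               ≡⟨ swap (q * q) E ⟩
      4 * (q * q) * (q * q) * E ≤⟨ q⁴E≤N ⟩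
      N                       <⟨ <suc/ (2 * q) ⟩
      2 * q * suc l           ≤⟨ ℕ.*-monoˡ-≤ (suc l) (ℕ.*-monoˡ-≤ q 2≤q) ⟩
      q * q * suc l           ∎))
      where
      swap : ∀ r E → r * (4 * r * E) ≡ 4 * r * r * E
      swap = ℕ-Solver.solve-∀
    rearrange : ∀ q l s N E → q * (4 * l * (1 + s) + 2 * (l * l) + 4 * q * (N * E))
      ≡ l * (s * (4 * q)) + l * (4 * q) + l * (l * (2 * q)) + N * (4 * (q * q) * E)
    rearrange = ℕ-Solver.solve-∀
    collect : ∀ l N → l * N + l * N + l * N + N * l ≡ 4 * l * N
    collect = ℕ-Solver.solve-∀

  ∑C̃ : ∀ {N} → Graph N → (Permutation N → Fin N) → ℕ
  ∑C̃ {N} G τ = ListAction.sum (map (λ σ → C̃ G (τ σ) σ) (permutations N))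

  -- For each σ the time `τ` σ is rounded down to a multiple of s, counting times from 0. Since `τ`
  -- may be any function of σ, this bounds the expected maximum over all times.
  ∑C̃-grid-bound : ∀ {N} (G : Graph N) K s l B .{{_ : NonZero N}} .{{_ : NonZero s}} → N ≤ K * s →
    (∀ t → ∑C̃ G (λ _ → t) ≤ B) → ∀ τ →
    let D = 2 * suc (maxDegree G) in
    4 * l * ∑C̃ G τ ≤ 4 * l * B + N ! * (4 * l * s + 2 * (l * l) + K * (N * (D * D)))
  ∑C̃-grid-bound {N} G K s l B N≤Ks C̃≤B τ =
    maximal-bound N (2 * suc (maxDegree G)) s l B f
      (λ j → prefixComponents-lipschitz G (suc (toℕ (grid j))) _) f≤B (λ σ → C̃ G (τ σ) σ)
      (λ σ → X≤ (τ σ) (vertices σ))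
    where
    grid : Fin K → Fin N
    -- As K s may exceed N, grid points are capped at the last time; the cap is inactive at the
    -- point chosen in `X≤`.
    grid j = fromℕ< (ℕ.≤-<-trans (ℕ.m⊓n≤n (toℕ j * s) (ℕ.pred N)) (ℕ.≤-reflexive (ℕ.suc-pred N)))
    f : Fin K → Vec (Fin N) N → ℕ
    f j = prefixComponents G (suc (toℕ (grid j))) (toℕ<n (grid j))
    f≤B : ∀ j → ∑arr N everything (f j) ≤ B
    f≤B j = ℕ.≤-trans (ℕ.≤-reflexive (sym (sum-permutations N (f j)))) (C̃≤B (grid j))
    X≤ : ∀ t v → ∃ λ j → prefixComponents G (suc (toℕ t)) (toℕ<n t) v ≤ f j v + s
    X≤ t v = j , prefixComponents-mono G (toℕ<n (grid j)) (toℕ<n t) s v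
        (s≤s (subst (_≤ toℕ t) (sym grid-j) js≤t))
        (ℕ.≤-trans (s≤s (subst (λ x → toℕ t ≤ s + x) (sym grid-j) t≤)) (ℕ.≤-reflexive (sym (ℕ.+-suc s _))))
      where
      j<K : toℕ t ℕ./ s < K
      j<K = ℕ.m<n*o⇒m/o<n (ℕ.<-≤-trans (toℕ<n t) N≤Ks)
      j = fromℕ< j<K
      js≤t : toℕ t ℕ./ s * s ≤ toℕ t
      js≤t = ℕ.m/n*n≤m (toℕ t) s
      t≤ : toℕ t ≤ s + toℕ t ℕ./ s * s
      t≤ = ℕ.≤-trans (ℕ.≤-reflexive (ℕ.m≡m%n+[m/n]*n (toℕ t) s))
        (ℕ.+-monoˡ-≤ (toℕ t ℕ./ s * s) (ℕ.<⇒≤ (ℕ.m%n<n (toℕ t) s)))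
      grid-j : toℕ (grid j) ≡ toℕ t ℕ./ s * s
      grid-j = trans (toℕ-fromℕ< _) (trans (cong (λ x → x * s ⊓ ℕ.pred N) (toℕ-fromℕ< j<K))
        (ℕ.m≤n⇒m⊓n≡m (ℕ.≤-trans js≤t (ℕ.<⇒≤pred (toℕ<n t)))))

  rescale : ∀ q l T B m N r .{{_ : NonZero l}} → q * r ≤ 4 * l * N →
    4 * l * T ≤ 4 * l * B + m * r → q * T ≤ q * B + m * N
  rescale q l T B m N r qr≤ T≤ = ℕ.*-cancelˡ-≤ (4 * l) {{ℕ.m*n≢0 4 l}} (begin
    4 * l * (q * T)                   ≡⟨ swap (4 * l) q T ⟩
    q * (4 * l * T)                   ≤⟨ ℕ.*-monoʳ-≤ q T≤ ⟩
    q * (4 * l * B + m * r)           ≡⟨ expand q (4 * l) B m r ⟩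
    4 * l * (q * B) + m * (q * r)     ≤⟨ ℕ.+-monoʳ-≤ (4 * l * (q * B)) (ℕ.*-monoʳ-≤ m qr≤) ⟩
    4 * l * (q * B) + m * (4 * l * N) ≡⟨ collect (4 * l) (q * B) m N ⟩
    4 * l * (q * B + m * N)           ∎)
    where
    open ℕ.≤-Reasoning
    swap : ∀ l q t → l * (q * t) ≡ q * (l * t)
    swap = ℕ-Solver.solve-∀
    expand : ∀ q l b m r → q * (l * b + m * r) ≡ l * (q * b) + m * (q * r)
    expand = ℕ-Solver.solve-∀
    collect : ∀ l b m n → l * b + m * (l * n) ≡ l * (b + m * n)
    collect = ℕ-Solver.solve-∀

  -- The grid has 4 q points. After division by q N! the error is N / q.
  ∑C̃-bound : ∀ {N} (G : Graph N) q .{{_ : NonZero q}} B → 2 ≤ q → 4 * q ≤ N →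
    let D = 2 * suc (maxDegree G) in
    4 * (q * q) * (q * q) * (D * D) ≤ N →
    (∀ t → ∑C̃ G (λ _ → t) ≤ B) →
    ∀ τ → q * ∑C̃ G τ ≤ q * B + N ! * N
  ∑C̃-bound {N} G q B 2≤q 4q≤N q⁴D²≤N C̃≤B τ =
    let D = 2 * suc (maxDegree G)
        s , l , s≢0 , N≤4qs , l≢0 , fits = grid-arithmetic N q (D * D) 2≤q 4q≤N q⁴D²≤N
        N≢0 = ℕ.>-nonZero (ℕ.<-≤-trans (ℕ.>-nonZero⁻¹ (4 * q) {{ℕ.m*n≢0 4 q}}) 4q≤N)
    in rescale q l (∑C̃ G τ) B (N !) N (4 * l * s + 2 * (l * l) + 4 * q * (N * (D * D))) {{l≢0}} fits
         (∑C̃-grid-bound G (4 * q) s l B {{N≢0}} {{s≢0}} N≤4qs C̃≤B τ)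

  -- Squaring 6 q² (D + 1) ≤ √N + 12 q² gives 36 q⁴ (D + 1)² ≤ 2 N + 288 q⁴, and
  -- 1152 = 4 · 288.
  threshold : ℕ → ℕ
  threshold q = 1152 * (q * q * (q * q))

  4*≤threshold : ∀ q .{{_ : NonZero q}} → 4 * q ≤ threshold q
  4*≤threshold q = ℕ.*-mono-≤ {4} {1152} {q} {q * q * (q * q)} (ℕ.m≤m+n 4 1148)
    (ℕ.≤-trans (ℕ.m≤m*n q q) (ℕ.m≤m*n (q * q) (q * q) {{ℕ.m*n≢0 q q}}))

  -- R / k is an approximant of √N from below, and the slack 6 q² k is the tolerance 1 in the degree
  -- hypothesis after clearing denominators.
  degree-bound-ℕ : ∀ N q D R k .{{_ : NonZero k}} → threshold q ≤ N → R * R ≤ N * (k * k) →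
    6 * (q * q) * D * k ≤ R + 6 * (q * q) * k →
    4 * (q * q) * (q * q) * (2 * suc D * (2 * suc D)) ≤ N
  -- The factor 9 makes the left side four times the square of 6 q² (D + 1). Of the 9 N on the
  -- right, 8 N come from √N and N absorbs `threshold`.
  degree-bound-ℕ N q D R k large R²≤ D≤ = ℕ.*-cancelˡ-≤ 9 (begin
    9 * (4 * Q * Q * (2 * suc D * (2 * suc D)))
      ≡⟨ regroup Q D ⟩
    4 * (a * a)
      ≤⟨ ℕ.*-monoʳ-≤ 4 a²≤ ⟩
    4 * (2 * N + 288 * (Q * Q))
      ≡⟨ distribute N (Q * Q) ⟩
    8 * N + threshold q
      ≤⟨ ℕ.+-monoʳ-≤ (8 * N) large ⟩
    8 * N + N
      ≡⟨ ℕ.+-comm (8 * N) N ⟩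
    9 * N ∎)
    where
    open ℕ.≤-Reasoning
    Q = q * q
    a = 6 * Q * suc D
    regroup : ∀ Q D → 9 * (4 * Q * Q * (2 * (1 + D) * (2 * (1 + D))))
      ≡ 4 * (6 * Q * (1 + D) * (6 * Q * (1 + D)))
    regroup = ℕ-Solver.solve-∀
    distribute : ∀ N P → 4 * (2 * N + 288 * P) ≡ 8 * N + 1152 * P
    distribute = ℕ-Solver.solve-∀
    ak≤ : a * k ≤ R + 12 * Q * k
    -- One 6 q² k comes from the tolerance and the other from replacing D by D + 1.
    ak≤ = begin
      6 * Q * suc D * k             ≡⟨ split Q D k ⟩
      6 * Q * D * k + 6 * Q * k     ≤⟨ ℕ.+-monoˡ-≤ (6 * Q * k) D≤ ⟩
      R + 6 * Q * k + 6 * Q * k     ≡⟨ merge R Q k ⟩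
      R + 12 * Q * k                ∎
      where
      split : ∀ Q D k → 6 * Q * (1 + D) * k ≡ 6 * Q * D * k + 6 * Q * k
      split = ℕ-Solver.solve-∀
      merge : ∀ R Q k → R + 6 * Q * k + 6 * Q * k ≡ R + 12 * Q * k
      merge = ℕ-Solver.solve-∀
    a²≤ : a * a ≤ 2 * N + 288 * (Q * Q)
    a²≤ = ℕ.*-cancelʳ-≤ _ _ (k * k) {{ℕ.m*n≢0 k k}} (begin
      a * a * (k * k)
        ≡⟨ interchange a k ⟩
      a * k * (a * k)
        ≤⟨ ℕ.*-mono-≤ ak≤ ak≤ ⟩
      (R + 12 * Q * k) * (R + 12 * Q * k)
        ≤⟨ square-sum R (12 * Q * k) ⟩
      2 * (R * R + 12 * Q * k * (12 * Q * k))
        ≤⟨ ℕ.*-monoʳ-≤ 2 (ℕ.+-monoˡ-≤ (12 * Q * k * (12 * Q * k)) R²≤) ⟩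
      2 * (N * (k * k) + 12 * Q * k * (12 * Q * k))
        ≡⟨ factor N Q k ⟩
      (2 * N + 288 * (Q * Q)) * (k * k) ∎)
      where
      interchange : ∀ a k → a * a * (k * k) ≡ a * k * (a * k)
      interchange = ℕ-Solver.solve-∀
      factor : ∀ N Q k → 2 * (N * (k * k) + 12 * Q * k * (12 * Q * k))
        ≡ (2 * N + 288 * (Q * Q)) * (k * k)
      factor = ℕ-Solver.solve-∀

-- Passage to the reals

open import Data.Integer.Base using (+_; +[1+_])
open import Data.Rational.Base using (ℚ; mkℚ; _+_; _*_; _-_; _≤_; _<_; ∣_∣; *≤*)

ι : ℕ → ℚ
ι n = + n / 1

/≃ : ∀ a k → ℚ.toℚᵘ (+ a / suc k) ℚᵘ.≃ ℚᵘ.mkℚᵘ (+ a) k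
/≃ a k = ℚ.toℚᵘ-fromℚᵘ (ℚᵘ.mkℚᵘ (+ a) k)

ι-+ : ∀ a b → ι (a ℕ.+ b) ≡ ι a + ι b
ι-+ a b = ℚ.toℚᵘ-injective (begin
  ℚ.toℚᵘ (ι (a ℕ.+ b))                    ≈⟨ /≃ (a ℕ.+ b) 0 ⟩
  ℚᵘ.mkℚᵘ (+ (a ℕ.+ b)) 0                 ≈⟨ ℚᵘ.*≡* (cong (ℤ._* + 1) (trans (ℤ.pos-+ a b) (sym (cong₂ ℤ._+_ (ℤ.*-identityʳ (+ a)) (ℤ.*-identityʳ (+ b)))))) ⟩
  ℚᵘ.mkℚᵘ (+ a) 0 ℚᵘ.+ ℚᵘ.mkℚᵘ (+ b) 0    ≈⟨ ℚᵘ.+-cong (/≃ a 0) (/≃ b 0) ⟨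
  ℚ.toℚᵘ (ι a) ℚᵘ.+ ℚ.toℚᵘ (ι b)          ≈⟨ ℚ.toℚᵘ-homo-+ (ι a) (ι b) ⟨
  ℚ.toℚᵘ (ι a + ι b)                      ∎)
  where open import Relation.Binary.Reasoning.Setoid ℚᵘ.≃-setoid

ι-* : ∀ a b → ι (a ℕ.* b) ≡ ι a * ι b
ι-* a b = ℚ.toℚᵘ-injective (begin
  ℚ.toℚᵘ (ι (a ℕ.* b))                    ≈⟨ /≃ (a ℕ.* b) 0 ⟩
  ℚᵘ.mkℚᵘ (+ (a ℕ.* b)) 0                 ≈⟨ ℚᵘ.*≡* (cong (ℤ._* + 1) (ℤ.pos-* a b)) ⟩
  ℚᵘ.mkℚᵘ (+ a) 0 ℚᵘ.* ℚᵘ.mkℚᵘ (+ b) 0    ≈⟨ ℚᵘ.*-cong (/≃ a 0) (/≃ b 0) ⟨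
  ℚ.toℚᵘ (ι a) ℚᵘ.* ℚ.toℚᵘ (ι b)          ≈⟨ ℚ.toℚᵘ-homo-* (ι a) (ι b) ⟨
  ℚ.toℚᵘ (ι a * ι b)                      ∎)
  where open import Relation.Binary.Reasoning.Setoid ℚᵘ.≃-setoid

ι-mono-≤ : ∀ {a b} → a ℕ.≤ b → ι a ≤ ι b
ι-mono-≤ {a} {b} a≤b = ℚ.toℚᵘ-cancel-≤
  (ℚᵘ.≤-respˡ-≃ (ℚᵘ.≃-sym (/≃ a 0)) (ℚᵘ.≤-respʳ-≃ (ℚᵘ.≃-sym (/≃ b 0))
    (ℚᵘ.*≤* (ℤ.*-monoʳ-≤-nonNeg (+ 1) (ℤ.+≤+ a≤b)))))

ι-cancel-≤ : ∀ {a b} → ι a ≤ ι b → a ℕ.≤ b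
ι-cancel-≤ {a} {b} ιa≤ιb
  with ℚᵘ.*≤* le ← ℚᵘ.≤-respˡ-≃ (/≃ a 0) (ℚᵘ.≤-respʳ-≃ (/≃ b 0) (ℚ.toℚᵘ-mono-≤ ιa≤ιb)) =
  ℤ.drop‿+≤+ (subst₂ ℤ._≤_ (ℤ.*-identityʳ (+ a)) (ℤ.*-identityʳ (+ b)) le)

/-*-ι : ∀ a n .{{_ : NonZero n}} → + a / n * ι n ≡ ι a
/-*-ι a n@(suc k) = ℚ.toℚᵘ-injective (begin
  ℚ.toℚᵘ (+ a / n * ι n)                    ≈⟨ ℚ.toℚᵘ-homo-* (+ a / n) (ι n) ⟩
  ℚ.toℚᵘ (+ a / n) ℚᵘ.* ℚ.toℚᵘ (ι n)        ≈⟨ ℚᵘ.*-cong (/≃ a k) (/≃ n 0) ⟩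
  ℚᵘ.mkℚᵘ (+ a) k ℚᵘ.* ℚᵘ.mkℚᵘ (+ n) 0      ≈⟨ ℚᵘ.*≡* (regroup (+ a) (+ n)) ⟩
  ℚᵘ.mkℚᵘ (+ a) 0                           ≈⟨ /≃ a 0 ⟨
  ℚ.toℚᵘ (ι a)                              ∎)
  where
  open import Relation.Binary.Reasoning.Setoid ℚᵘ.≃-setoid
  regroup : ∀ x y → x ℤ.* y ℤ.* + 1 ≡ x ℤ.* (y ℤ.* + 1)
  regroup = ℤ-Solver.solve-∀

0≤ι : ∀ n → 0ℚ ≤ ι n
0≤ι n = ι-mono-≤ {0} {n} z≤n

0<ι : ∀ n .{{_ : NonZero n}} → 0ℚ < ι n
0<ι n = ℚ.<-≤-trans (ℚ.positive⁻¹ 1ℚ) (ι-mono-≤ {1} (ℕ.>-nonZero⁻¹ n))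

*-monoˡ : ∀ {r p q} → 0ℚ ≤ r → p ≤ q → r * p ≤ r * q
*-monoˡ {r} 0≤r = ℚ.*-monoˡ-≤-nonNeg r {{ℚ.nonNegative 0≤r}}

*-monoʳ : ∀ {r p q} → 0ℚ ≤ r → p ≤ q → p * r ≤ q * r
*-monoʳ {r} 0≤r = ℚ.*-monoʳ-≤-nonNeg r {{ℚ.nonNegative 0≤r}}

*-cancelʳ : ∀ {r p q} → 0ℚ < r → p * r ≤ q * r → p ≤ q
*-cancelʳ {r} 0<r = ℚ.*-cancelʳ-≤-pos r {{ℚ.positive 0<r}}

≤+ : ∀ {p q δ} → 0ℚ < δ → p ≤ q → p ≤ q + δ
≤+ {p} {q} {δ} 0<δ p≤q = ℚ.≤-trans p≤q
  (subst (_≤ q + δ) (ℚ.+-identityʳ q) (ℚ.+-monoʳ-≤ q (ℚ.<⇒≤ 0<δ)))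

-- For q = 1 + ⌊1/y⌋ one has 1 ≤ q y ≤ 1 + y ≤ 2. Adding one to the floor, instead of taking the
-- ceiling, gives 2 ≤ q even for y = 1.
reciprocal : ∀ y → 0ℚ < y → y ≤ 1ℚ → ∃ λ q → 2 ℕ.≤ q × 1ℚ ≤ ι q * y × ι q * y ≤ ι 2
reciprocal (mkℚ (+ 0) d _) (ℚ.*<* (ℤ.+<+ ())) _
reciprocal (mkℚ (ℤ.-[1+ _ ]) d _) (ℚ.*<* ()) _
reciprocal y@(mkℚ +[1+ p ] d _) 0<y y≤1 = q , s≤s 1≤b/a , lower , upper
  where
  a = suc p
  b = suc d
  q = suc (b ℕ./ a)
  y*ιb : y * ι b ≡ ι a
  y*ιb = trans (cong (_* ι b) (sym (ℚ.fromℚᵘ-toℚᵘ y))) (/-*-ι a b)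
  qyb : ι q * y * ι b ≡ ι (q ℕ.* a)
  qyb = trans (ℚ.*-assoc (ι q) y (ι b)) (trans (cong (ι q *_) y*ιb) (sym (ι-* q a)))
  a≤b : a ℕ.≤ b
  a≤b = ι-cancel-≤ (subst₂ _≤_ y*ιb (ℚ.*-identityˡ (ι b)) (*-monoʳ (0≤ι b) y≤1))
  1≤b/a : 1 ℕ.≤ b ℕ./ a
  1≤b/a = ℕ.m≥n⇒m/n>0 a≤b
  lower : 1ℚ ≤ ι q * y
  lower = *-cancelʳ (0<ι b) (subst₂ _≤_ (sym (ℚ.*-identityˡ (ι b))) (sym qyb) (ι-mono-≤ (begin
    b                           ≡⟨ ℕ.m≡m%n+[m/n]*n b a ⟩
    b ℕ.% a ℕ.+ b ℕ./ a ℕ.* a   ≤⟨ ℕ.+-monoˡ-≤ (b ℕ./ a ℕ.* a) (ℕ.<⇒≤ (ℕ.m%n<n b a)) ⟩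
    q ℕ.* a                     ∎)))
    where open ℕ.≤-Reasoning
  upper : ι q * y ≤ ι 2
  upper = *-cancelʳ (0<ι b) (subst₂ _≤_ (sym qyb) (ι-* 2 b) (ι-mono-≤ (begin
    a ℕ.+ b ℕ./ a ℕ.* a   ≤⟨ ℕ.+-mono-≤ a≤b (ℕ.m/n*n≤m b a) ⟩
    b ℕ.+ b               ≡⟨ cong (b ℕ.+_) (ℕ.+-identityʳ b) ⟨
    2 ℕ.* b               ∎)))
    where open ℕ.≤-Reasoning

∣-∣≤⇒ : ∀ x y {η} → ∣ x - y ∣ ≤ η → x ≤ y + η × y ≤ x + η
∣-∣≤⇒ x y {η} le =
    subst (_≤ y + η) (cancel x y) (ℚ.+-monoʳ-≤ y (ℚ.≤-trans (p≤∣p∣ (x - y)) le))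
  , subst (_≤ x + η) (cancel y x) (ℚ.+-monoʳ-≤ x (ℚ.≤-trans (p≤∣p∣ (y - x)) (subst (_≤ η) (flip x y) le)))
  where
  open +-*-Solver
  cancel : ∀ a b → b + (a - b) ≡ a
  cancel = solve 2 (λ a b → b :+ (a :- b) := a) refl
  neg : ∀ a b → ℚ.- (a - b) ≡ b - a
  neg = solve 2 (λ a b → :- (a :- b) := b :- a) refl
  flip : ∀ a b → ∣ a - b ∣ ≡ ∣ b - a ∣
  flip a b = trans (sym (ℚ.∣-p∣≡∣p∣ (a - b))) (cong ∣_∣ (neg a b))
  p≤∣p∣ : ∀ p → p ≤ ∣ p ∣
  p≤∣p∣ p with ℚ.≤-total 0ℚ p
  ... | inj₁ 0≤p = ℚ.≤-reflexive (sym (ℚ.0≤p⇒∣p∣≡p 0≤p))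
  ... | inj₂ p≤0 = ℚ.≤-trans p≤0 (ℚ.0≤∣p∣ p)

-- The constant is 2 · (17/16) / (15/16), where 2 is the rounding loss in
-- reciprocal and 1/16 the relative accuracy to which ε is approximated.
scale : ∀ ε → fromℚ 0ℚ <ℝ ε → ε <ℝ fromℚ 1ℚ → ∃ λ q → 2 ℕ.≤ q × ∃ λ M → ∀ n → M ℕ.≤ n →
  1ℚ ≤ ι q * seq ε n × ι q * seq ε n ≤ + 34 / 15
scale ε (δ , 0<δ , K₀ , δ≤) (δ′ , 0<δ′ , K₂ , ≤1)
  with K₁ , close ← cauchy ε (+ 1 / 16 * δ) (ℚ.positive⁻¹ _ {{ℚ.pos*pos⇒pos (+ 1 / 16) δ {{ℚ.positive 0<δ}}}}) =
  let q , 2≤q , 1≤qy , qy≤2 = reciprocal y 0<y y≤1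
  in q , 2≤q , M , λ n M≤n →
    let εn≤ , x≤ = ∣-∣≤⇒ (seq ε n) x (close n M (ℕ.≤-trans K₁≤M M≤n) K₁≤M)
    in ℚ.≤-trans 1≤qy (*-monoˡ (0≤ι q) (lower (seq ε n) x≤))
     , (begin
        ι q * seq ε n              ≤⟨ *-monoˡ (0≤ι q) (upper (seq ε n) εn≤) ⟩
        ι q * (+ 17 / 15 * y)      ≡⟨ swap (ι q) (+ 17 / 15) y ⟩
        + 17 / 15 * (ι q * y)      ≤⟨ *-monoˡ (ℚ.nonNegative⁻¹ (+ 17 / 15)) qy≤2 ⟩
        + 34 / 15                  ∎)
  where
  open ℚ.≤-Reasoning
  M = K₀ ℕ.⊔ K₁ ℕ.⊔ K₂
  K₀≤M : K₀ ℕ.≤ M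
  K₀≤M = ℕ.≤-trans (ℕ.m≤m⊔n K₀ K₁) (ℕ.m≤m⊔n _ K₂)
  K₁≤M : K₁ ℕ.≤ M
  K₁≤M = ℕ.≤-trans (ℕ.m≤n⊔m K₀ K₁) (ℕ.m≤m⊔n _ K₂)
  x = seq ε M
  -- Shrinking x keeps y below all later approximants of ε, so that 1 ≤ q y carries over to them.
  y = + 15 / 16 * x
  δ≤x : δ ≤ x
  δ≤x = subst (_≤ x) (ℚ.+-identityˡ δ) (δ≤ M K₀≤M)
  x≤1 : x ≤ 1ℚ
  x≤1 = ℚ.≤-trans (≤+ 0<δ′ ℚ.≤-refl) (≤1 M (ℕ.m≤n⊔m _ K₂))
  0<y : 0ℚ < y
  0<y = ℚ.positive⁻¹ y {{ℚ.pos*pos⇒pos (+ 15 / 16) x {{ℚ.positive (ℚ.<-≤-trans 0<δ δ≤x)}}}}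
  y≤1 : y ≤ 1ℚ
  y≤1 = ℚ.≤-trans (*-monoˡ (ℚ.nonNegative⁻¹ (+ 15 / 16)) x≤1) (*≤* (ℤ.+≤+ (ℕ.m≤m+n 15 1)))
  swap : ∀ a b c → a * (b * c) ≡ b * (a * c)
  swap = solve 3 (λ a b c → a :* (b :* c) := b :* (a :* c)) refl
    where open +-*-Solver
  -- As δ bounds x from below, the absolute tolerance δ/16 is also a relative one.
  η≤ : + 1 / 16 * δ ≤ + 1 / 16 * x
  η≤ = *-monoˡ (ℚ.nonNegative⁻¹ (+ 1 / 16)) δ≤x
  lower : ∀ z → x ≤ z + + 1 / 16 * δ → y ≤ z
  lower z x≤ = subst₂ _≤_ (part x) (cancel z (+ 1 / 16 * x)) (ℚ.+-monoˡ-≤ (ℚ.- (+ 1 / 16 * x))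
    (ℚ.≤-trans x≤ (ℚ.+-monoʳ-≤ z η≤)))
    where
    open +-*-Solver
    part : ∀ x → x - + 1 / 16 * x ≡ + 15 / 16 * x
    part = solve 1 (λ x → x :- con (+ 1 / 16) :* x := con (+ 15 / 16) :* x) refl
    cancel : ∀ z w → z + w - w ≡ z
    cancel = solve 2 (λ z w → z :+ w :- w := z) refl
  upper : ∀ z → z ≤ x + + 1 / 16 * δ → z ≤ + 17 / 15 * y
  upper z z≤ = subst (z ≤_) (part x) (ℚ.≤-trans z≤ (ℚ.+-monoʳ-≤ x η≤))
    where
    open +-*-Solver
    part : ∀ x → x + + 1 / 16 * x ≡ + 17 / 15 * (+ 15 / 16 * x)
    part = solve 1 (λ x → x :+ con (+ 1 / 16) :* x := con (+ 17 / 15) :* (con (+ 15 / 16) :* x)) refl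

-- Multiplication by 6 q² k turns the main term into (6/32) (q e)² R. The constant 6 is the largest
-- integer that works: (6/32) (34/15)² = 289/300.
clear-denominators : ∀ q D R k e .{{_ : NonZero k}} → 1ℚ ≤ ι q * e → ι q * e ≤ + 34 / 15 →
  ι D ≤ + 1 / 32 * (e * e) * (+ R / k) + 1ℚ →
  6 ℕ.* (q ℕ.* q) ℕ.* D ℕ.* k ℕ.≤ R ℕ.+ 6 ℕ.* (q ℕ.* q) ℕ.* k
clear-denominators q D R k e 1≤qe qe≤ D≤ = ι-cancel-≤ (begin
  ι (6 ℕ.* (q ℕ.* q) ℕ.* D ℕ.* k)
    ≡⟨ trans (ι-* c′ k) (cong (_* ι k) (trans (ι-* (6 ℕ.* (q ℕ.* q)) D) (cong (_* ι D) ι-c))) ⟩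
  ι 6 * (ι q * ι q) * ι D * ι k
    ≤⟨ *-monoʳ (0≤ι k) (*-monoˡ 0≤c D≤) ⟩
  ι 6 * (ι q * ι q) * (+ 1 / 32 * (e * e) * (+ R / k) + 1ℚ) * ι k
    ≡⟨ regroup (ι q) e (+ R / k) (ι k) ⟩
  + 6 / 32 * (ι q * e * (ι q * e)) * (+ R / k * ι k) + ι 6 * (ι q * ι q) * ι k
    ≡⟨ cong (λ z → + 6 / 32 * (ι q * e * (ι q * e)) * z + ι 6 * (ι q * ι q) * ι k) (/-*-ι R k) ⟩
  + 6 / 32 * (ι q * e * (ι q * e)) * ι R + ι 6 * (ι q * ι q) * ι k
    ≤⟨ ℚ.+-monoˡ-≤ (ι 6 * (ι q * ι q) * ι k) (*-monoʳ (0≤ι R) factor≤1) ⟩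
  1ℚ * ι R + ι 6 * (ι q * ι q) * ι k
    ≡⟨ cong₂ _+_ (ℚ.*-identityˡ (ι R)) (sym (trans (ι-* (6 ℕ.* (q ℕ.* q)) k) (cong (_* ι k) ι-c))) ⟩
  ι R + ι (6 ℕ.* (q ℕ.* q) ℕ.* k)
    ≡⟨ ι-+ R _ ⟨
  ι (R ℕ.+ 6 ℕ.* (q ℕ.* q) ℕ.* k) ∎)
  where
  open ℚ.≤-Reasoning
  c′ = 6 ℕ.* (q ℕ.* q) ℕ.* D
  ι-c : ι (6 ℕ.* (q ℕ.* q)) ≡ ι 6 * (ι q * ι q)
  ι-c = trans (ι-* 6 (q ℕ.* q)) (cong (ι 6 *_) (ι-* q q))
  0≤c : 0ℚ ≤ ι 6 * (ι q * ι q)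
  0≤c = subst (0ℚ ≤_) ι-c (0≤ι (6 ℕ.* (q ℕ.* q)))
  regroup : ∀ q e r k → ι 6 * (q * q) * (+ 1 / 32 * (e * e) * r + 1ℚ) * k
    ≡ + 6 / 32 * (q * e * (q * e)) * (r * k) + ι 6 * (q * q) * k
  regroup = solve 4 (λ q e r k → con (ι 6) :* (q :* q) :* (con (+ 1 / 32) :* (e :* e) :* r :+ con 1ℚ) :* k
    := con (+ 6 / 32) :* (q :* e :* (q :* e)) :* (r :* k) :+ con (ι 6) :* (q :* q) :* k) refl
    where open +-*-Solver
  0≤qe : 0ℚ ≤ ι q * e
  0≤qe = ℚ.≤-trans (ℚ.nonNegative⁻¹ 1ℚ) 1≤qe
  factor≤1 : + 6 / 32 * (ι q * e * (ι q * e)) ≤ 1ℚ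
  factor≤1 = begin
    + 6 / 32 * (ι q * e * (ι q * e))      ≤⟨ *-monoˡ (ℚ.nonNegative⁻¹ (+ 6 / 32)) (ℚ.≤-trans (*-monoˡ 0≤qe qe≤) (*-monoʳ (ℚ.nonNegative⁻¹ (+ 34 / 15)) qe≤)) ⟩
    + 6 / 32 * (+ 34 / 15 * (+ 34 / 15))  ≤⟨ *≤* (ℤ.+≤+ (ℕ.m≤m+n 289 11)) ⟩
    1ℚ                                    ∎

-- Payoffs, stopping times and the conclusion

payoff-≤⇒∑C̃-≤ : ∀ {N} (G : Graph N) τ τ′ → payoff G τ ≤ payoff G τ′ → ∑C̃ G τ ℕ.≤ ∑C̃ G τ′
payoff-≤⇒∑C̃-≤ {N} G τ τ′ p≤ = ι-cancel-≤ (subst₂ _≤_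
  (/-*-ι (∑C̃ G τ) (N !) {{N ℕ.!≢0}}) (/-*-ι (∑C̃ G τ′) (N !) {{N ℕ.!≢0}})
  (*-monoʳ (0≤ι (N !)) p≤))

payoff-bound : ∀ {N} (G : Graph N) τ τ′ q .{{_ : NonZero q}} e → 1ℚ ≤ ι q * e →
  q ℕ.* ∑C̃ G τ ℕ.≤ q ℕ.* ∑C̃ G τ′ ℕ.+ N ! ℕ.* N →
  payoff G τ ≤ payoff G τ′ + e * ι N
payoff-bound {N} G τ τ′ q e 1≤qe ∑≤ = *-cancelʳ (0<ι (q ℕ.* N !) {{ℕ.m*n≢0 q (N !) {{it}} {{N ℕ.!≢0}}}}) (begin
  payoff G τ * ι (q ℕ.* N !)
    ≡⟨ payoff-* τ ⟩
  ι (q ℕ.* ∑C̃ G τ)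
    ≤⟨ ι-mono-≤ ∑≤ ⟩
  ι (q ℕ.* ∑C̃ G τ′ ℕ.+ N ! ℕ.* N)
    ≡⟨ trans (ι-+ (q ℕ.* ∑C̃ G τ′) (N ! ℕ.* N)) (cong₂ _+_ (sym (payoff-* τ′)) (ι-* (N !) N)) ⟩
  payoff G τ′ * ι (q ℕ.* N !) + ι (N !) * ι N
    ≡⟨ cong (λ z → payoff G τ′ * ι (q ℕ.* N !) + z) (ℚ.*-identityˡ (ι (N !) * ι N)) ⟨
  payoff G τ′ * ι (q ℕ.* N !) + 1ℚ * (ι (N !) * ι N)
    ≤⟨ ℚ.+-monoʳ-≤ (payoff G τ′ * ι (q ℕ.* N !)) (*-monoʳ 0≤N!N 1≤qe) ⟩
  payoff G τ′ * ι (q ℕ.* N !) + ι q * e * (ι (N !) * ι N)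
    ≡⟨ cong (λ z → payoff G τ′ * z + ι q * e * (ι (N !) * ι N)) (ι-* q (N !)) ⟩
  payoff G τ′ * (ι q * ι (N !)) + ι q * e * (ι (N !) * ι N)
    ≡⟨ factor (payoff G τ′) (ι q) (ι (N !)) e (ι N) ⟩
  (payoff G τ′ + e * ι N) * (ι q * ι (N !))
    ≡⟨ cong ((payoff G τ′ + e * ι N) *_) (ι-* q (N !)) ⟨
  (payoff G τ′ + e * ι N) * ι (q ℕ.* N !) ∎)
  where
  open ℚ.≤-Reasoning
  0≤N!N : 0ℚ ≤ ι (N !) * ι N
  0≤N!N = subst (0ℚ ≤_) (ι-* (N !) N) (0≤ι (N ! ℕ.* N))
  swap : ∀ p q m → p * (q * m) ≡ q * (p * m)
  swap = solve 3 (λ p q m → p :* (q :* m) := q :* (p :* m)) refl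
    where open +-*-Solver
  factor : ∀ p q m e n → p * (q * m) + q * e * (m * n) ≡ (p + e * n) * (q * m)
  factor = solve 5 (λ p q m e n → p :* (q :* m) :+ q :* e :* (m :* n) := (p :+ e :* n) :* (q :* m)) refl
    where open +-*-Solver
  payoff-* : ∀ τ → payoff G τ * ι (q ℕ.* N !) ≡ ι (q ℕ.* ∑C̃ G τ)
  payoff-* τ = begin-equality
    payoff G τ * ι (q ℕ.* N !)       ≡⟨ cong (payoff G τ *_) (ι-* q (N !)) ⟩
    payoff G τ * (ι q * ι (N !))     ≡⟨ swap (payoff G τ) (ι q) (ι (N !)) ⟩
    ι q * (payoff G τ * ι (N !))     ≡⟨ cong (ι q *_) (/-*-ι (∑C̃ G τ) (N !) {{N ℕ.!≢0}}) ⟩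
    ι q * ι (∑C̃ G τ)                 ≡⟨ ι-* q (∑C̃ G τ) ⟨
    ι (q ℕ.* ∑C̃ G τ)                 ∎

-- Each event `τ` = t is empty or the whole space, and both are closed under agreement up to t. The
-- blind optimum therefore competes in the full information game, which gives the lower bound.
blind⇒full : ∀ {N} τ → IsStoppingTime (blind N) τ → IsStoppingTime (full N) τ
blind⇒full τ stop t σ π τσ≡t _ with stop t
... | inj₁ (⊆∅ , _) = contradiction τσ≡t ⊆∅
... | inj₂ (_ , U⊆) = U⊆ _

constant-blind : ∀ {N} (t : Fin N) → IsStoppingTime (blind N) (λ _ → t)
constant-blind t s with t Fin.≟ s
... | yes t≡s = inj₂ (_ , λ _ → t≡s)
... | no  t≢s = inj₁ (t≢s , λ ())

payoff-limit : ∀ ε q M → 2 ℕ.≤ q →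
  (∀ n → M ℕ.≤ n → 1ℚ ≤ ι q * seq ε n × ι q * seq ε n ≤ + 34 / 15) →
  ∀ N → threshold q ℕ.≤ N →
  (G : Graph N) → fromℕ (maxDegree G) ≤ℝ fromℚ (+ 1 / 32) *ℝ (ε *ℝ ε) *ℝ √ N →
  ∀ τ τ′ → (∀ t → payoff G (λ _ → t) ≤ payoff G τ′) →
  fromℚ (payoff G τ) ≤ℝ fromℚ (payoff G τ′) +ℝ ε *ℝ fromℕ N
payoff-limit ε q M 2≤q q≈1/ε N N≥ G D≤ τ τ′ τ′-best δ 0<δ =
  -- The rational inequality already holds at every index from M on; δ is added as slack.
  M , λ i M≤i → ≤+ {payoff G τ} {payoff G τ′ + seq ε i * ι N} 0<δ
    (payoff-bound G τ τ′ q {{q≢0}} (seq ε i) (proj₁ (q≈1/ε i M≤i)) ∑≤)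
  where
  q≢0 : NonZero q
  q≢0 = ℕ.>-nonZero (ℕ.<⇒≤ 2≤q)
  -- Tolerance 1 suffices in the degree hypothesis, as `threshold` absorbs it. One index n beyond K
  -- and M then yields an inequality between rationals.
  K = proj₁ (D≤ 1ℚ (ℚ.positive⁻¹ 1ℚ))
  n = K ℕ.⊔ M
  R = ⌊√ N ℕ.* (suc n ℕ.* suc n) ⌋
  D≤ₙ : ι (maxDegree G) ≤ + 1 / 32 * (seq ε n * seq ε n) * (+ R / suc n) + 1ℚ
  D≤ₙ = proj₂ (D≤ 1ℚ (ℚ.positive⁻¹ 1ℚ)) n (ℕ.m≤m⊔n K M)
  q≈1/εₙ = q≈1/ε n (ℕ.m≤n⊔m K M)
  ∑≤ : q ℕ.* ∑C̃ G τ ℕ.≤ q ℕ.* ∑C̃ G τ′ ℕ.+ N ! ℕ.* N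
  ∑≤ = ∑C̃-bound G q {{q≢0}} (∑C̃ G τ′) 2≤q (ℕ.≤-trans (4*≤threshold q {{q≢0}}) N≥)
    (degree-bound-ℕ N q (maxDegree G) R (suc n) N≥ (⌊√⌋-lower (N ℕ.* (suc n ℕ.* suc n)))
      (clear-denominators q (maxDegree G) R (suc n) (seq ε n) (proj₁ q≈1/εₙ) (proj₂ q≈1/εₙ) D≤ₙ))
    (λ t → payoff-≤⇒∑C̃-≤ G (λ _ → t) τ′ (τ′-best t)) τ

theorem1 : ∀ (ε : ℝ) → fromℚ 0ℚ <ℝ ε → ε <ℝ fromℚ 1ℚ →
    ∃ λ (Nε : ℕ) →
    ∀ (N : ℕ) → N ≥ Nε →
    ∀ (G : Graph N) → fromℕ (maxDegree G) ≤ℝ fromℚ (+ 1 / 32) *ℝ (ε *ℝ ε) *ℝ √ N →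
    ∀ (τᶠ : Permutation N → Fin N) → IsOptimal G (full N) τᶠ →
    ∀ (τᵇ : Permutation N → Fin N) → IsOptimal G (blind N) τᵇ →
    fromℚ (payoff G τᵇ) ≤ℝ fromℚ (payoff G τᶠ)
    × fromℚ (payoff G τᶠ) ≤ℝ fromℚ (payoff G τᵇ) +ℝ ε *ℝ fromℕ N
theorem1 ε 0<ε ε<1 =
  let q , 2≤q , M , q≈1/ε = scale ε 0<ε ε<1
  in threshold q , λ N N≥ G D≤ τᶠ (_ , τᶠ-best) τᵇ (τᵇ-stops , τᵇ-best) →
    (λ δ 0<δ → 0 , λ _ _ → ≤+ 0<δ (τᶠ-best τᵇ (blind⇒full τᵇ τᵇ-stops)))
    , payoff-limit ε q M 2≤q q≈1/ε N N≥ G D≤ τᶠ τᵇ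
        (λ t → τᵇ-best (λ _ → t) (constant-blind t))
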